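{- For sets without proper arithmetic progressions of length $3$ the following exact values hold: $r_3(\mathbb{Z}_4^1)=2$, $r_3(\mathbb{Z}_4^2)=6$, $r_3(\mathbb{Z}_4^3)=16$, $r_3(\mathbb{Z}_4^4)=42$, and $r_3(\mathbb{Z}_4^5)=124$.
   Context: $\mathbb{Z}_m^n$ denotes the additive group $(\mathbb{Z}/m\mathbb{Z})^n$. A proper arithmetic progression of length $k$ in $\mathbb{Z}_m^n$ is a sequence $x, x+d, \ldots, x+(k-1)d$ (with $x,d\in\mathbb{Z}_m^n$) whose $k$ elements are pairwise distinct. $r_k(\mathbb{Z}_m^n)$ denotes the maximal size of a set $S\subseteq\mathbb{Z}_m^n$ that does not contain a proper arithmetic progression of length $k$. -}

module Defs where

open import Data.Fin.Base using (Fin; toℕ)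
open import Data.List.Base using (List; iterate; length)
open import Data.List.Relation.Binary.Subset.Propositional using (_⊆_)
open import Data.List.Relation.Unary.Unique.Propositional using (Unique)
open import Data.Nat.Base using (ℕ; NonZero; _+_; _≤_)
open import Data.Nat.DivMod using (_mod_)
open import Data.Product.Base using (∃-syntax; _×_)
open import Data.Vec.Base using (Vec; zipWith)
open import Relation.Binary.PropositionalEquality using (_≡_)
open import Relation.Nullary using (¬_)

infix  8 ℤ/_^_
infixl 6 _⊕_

-- Residues modulo m are represented by their least non-negative
-- representatives, so equality in the group is propositional equality.
ℤ/_^_ : ℕ → ℕ → Set
ℤ/ m ^ n = Vec (Fin m) n

_⊕_ : ∀ {m n} .{{_ : NonZero m}} → ℤ/ m ^ n → ℤ/ m ^ n → ℤ/ m ^ n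
_⊕_ {m} = zipWith (λ a b → (toℕ a + toℕ b) mod m)

-- x , x + d , … , x + (k - 1) d
progression : ∀ {m n} .{{_ : NonZero m}} → ℕ → ℤ/ m ^ n → ℤ/ m ^ n → List (ℤ/ m ^ n)
progression k x d = iterate (_⊕ d) x k

-- A progression is proper when its terms are pairwise distinct, i.e. Unique.
ProgressionFree : ∀ {m n} .{{_ : NonZero m}} → ℕ → List (ℤ/ m ^ n) → Set
ProgressionFree k S = ∀ x d → Unique (progression k x d) → ¬ (progression k x d ⊆ S)

-- r k ⟨ℤ/ m ^ n ⟩≐ N says that r_k(ℤ_m^n) exists and equals N.  Finite sets are
-- duplicate-free lists, so that length is cardinality.
r_⟨ℤ/_^_⟩≐_ : ℕ → (m n : ℕ) .{{_ : NonZero m}} → ℕ → Set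
r k ⟨ℤ/ m ^ n ⟩≐ N =
    (∃[ S ] Unique S × ProgressionFree {m} {n} k S × length S ≡ N)
  × (∀ S → Unique S → ProgressionFree {m} {n} k S → length S ≤ N)

{-# OPTIONS --safe #-}
module Submission where

-- Write a point of (ℤ/4)ⁿ as u + 2b with u, b ∈ {0,1}ⁿ.  A proper progression
-- of length 3 has ends u + 2b and u + 2c with b ≠ c, and its middle term can be
-- any point lying over u + b + c modulo 2.  So if X ⊆ 𝔽₂ⁿ is the reduction of a
-- progression-free set modulo 2, the fibre B over u satisfies u + b + c ∉ X for
-- distinct b, c ∈ B, and the maximal size of a fibre is the independence number
-- of the Cayley graph of 𝔽₂ⁿ with connection set (X + u) ∖ {0}.  The maximum
-- over X of the sum of these numbers is invariant under affine maps, so it has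
-- to be bounded only for one X in every affine class.  The classes are
-- enumerated by adding one point at a time, which is verified from explicit
-- affine maps; sets with more than 2ⁿ⁻¹ elements are treated as complements.

open import Defs
import Algebra.Properties.CommutativeSemigroup as CommutativeSemigroupProperties
open import Data.Bool.Base using (Bool; true; false; _∧_; _∨_; _xor_; not; if_then_else_; T)
open import Data.Bool.ListAction using (all; any)
open import Data.Bool.Properties
  using (T?; T-∧; T-∨; xor-assoc; xor-comm; xor-identityˡ; xor-same; not-involutive)
  renaming (_≟_ to _≟ᵇ_)
open import Data.Empty using (⊥-elim)
open import Data.Fin.Base using (Fin; toℕ)
open import Data.Fin.Patterns using (0F; 1F; 2F; 3F)
open import Data.Fin.Properties as Fin using ()
open import Data.List.Base using (List; []; _∷_; _++_; map; length; filter; foldr; concatMap)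
open import Data.List.Membership.Propositional using (_∈_; find)
open import Data.List.Membership.Propositional.Properties
open import Data.List.Properties using (length-++; length-map; length-++-sucʳ)
open import Data.List.Relation.Binary.Subset.Propositional using (_⊆_)
open import Data.List.Relation.Unary.All as All using (All; []; _∷_)
import Data.List.Relation.Unary.All.Properties as All
open import Data.List.Relation.Unary.AllPairs using ([]; _∷_)
open import Data.List.Relation.Unary.Any as Any using (here; there)
import Data.List.Relation.Unary.Any.Properties as Any
open import Data.List.Relation.Unary.Unique.Propositional using (Unique)
open import Data.List.Relation.Unary.Unique.Propositional.Properties as Unique using ()
open import Data.Nat.Base
open import Data.Nat.DivMod using (_mod_; _/_; _%_; m*n/n≡m; /-monoˡ-≤)
open import Data.Nat.ListAction using (sum)
open import Data.Nat.Properties hiding (_≟_)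
open import Data.Product.Base using (_×_; _,_; proj₁; proj₂; ∃; ∃-syntax)
open import Data.Product.Properties using () renaming (≡-dec to ×-≡-dec)
open import Data.Sum.Base using (_⊎_; inj₁; inj₂; [_,_]′)
open import Data.Unit.Base using (tt)
open import Data.Vec.Base as Vec using (Vec; []; _∷_; replicate; zipWith)
open import Data.Vec.Properties
  using (∷-injective; ∷-injectiveʳ; zipWith-assoc; zipWith-comm; zipWith-identityˡ)
  renaming (≡-dec to Vec-≡-dec)
open import Function.Base using (_∘_; case_of_)
open import Function.Bundles using (module Equivalence)
open import Relation.Binary.Definitions using (DecidableEquality)
open import Relation.Binary.PropositionalEquality
open import Relation.Nullary using (¬_; Dec; yes; no; contradiction)
open import Relation.Nullary.Decidable using (from-yes; isYes; toWitness; ¬?; _×-dec_; _→-dec_)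
open import Relation.Unary using (Decidable)

open Equivalence using (to)

private
  variable
    A : Set
    n k : ℕ

-- Only differences `b + c` inside a fibre enter the condition, so the carries of ℤ/4 cancel and the
-- full affine group of 𝔽₂ⁿ acts. For n = 5 this reduces the 2³² sets X to 382 classes; pairing
-- complements leaves 210 representatives in the table. Everything about these classes is decided by
-- evaluation. The tables contain only witnesses, all of which are rechecked: an error in them can
-- make the check fail but cannot let a false bound pass. The same holds for fuel and for lists of
-- symmetries: too little of either gives a weaker bound or a smaller orbit, never an unsound one.
-- For the lower bounds X consists of the vectors of weight at least t. A fibre over u is then a
-- binary code on the support of u, whose minimum distance has to exceed the weight of u minus t.

unique-length : {xs ys : List A} → Unique xs → xs ⊆ ys → length xs ≤ length ys
unique-length {xs = []}     _             _     = z≤n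
unique-length {xs = x ∷ xs} (x∉xs ∷ xs!) xs⊆ys with ∈-∃++ (xs⊆ys (here refl))
... | as , bs , refl = begin
  suc (length xs)         ≤⟨ s≤s (unique-length xs! λ z∈xs → skip z∈xs (∈-++⁻ as (xs⊆ys (there z∈xs)))) ⟩
  suc (length (as ++ bs)) ≡⟨ length-++-sucʳ as x bs ⟨
  length (as ++ x ∷ bs)   ∎
  where
  open ≤-Reasoning
  skip : ∀ {z} → z ∈ xs → z ∈ as ⊎ z ∈ x ∷ bs → z ∈ as ++ bs
  skip z∈xs (inj₁ z∈as)         = ∈-++⁺ˡ z∈as
  skip z∈xs (inj₂ (here refl))  = contradiction refl (All.lookup x∉xs z∈xs)
  skip z∈xs (inj₂ (there z∈bs)) = ∈-++⁺ʳ as z∈bs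

-- The vector space 𝔽₂ⁿ

𝔽₂^_ : ℕ → Set
𝔽₂^ n = Vec Bool n

infixl 6 _⊞_

_⊞_ : 𝔽₂^ n → 𝔽₂^ n → 𝔽₂^ n
_⊞_ = zipWith _xor_

𝟎 : 𝔽₂^ n
𝟎 = replicate _ false

_≟_ : DecidableEquality (𝔽₂^ n)
_≟_ = Vec-≡-dec _≟ᵇ_

⊞-assoc : (u v w : 𝔽₂^ n) → (u ⊞ v) ⊞ w ≡ u ⊞ (v ⊞ w)
⊞-assoc = zipWith-assoc xor-assoc

⊞-comm : (u v : 𝔽₂^ n) → u ⊞ v ≡ v ⊞ u
⊞-comm = zipWith-comm xor-comm

⊞-identityˡ : (u : 𝔽₂^ n) → 𝟎 ⊞ u ≡ u
⊞-identityˡ = zipWith-identityˡ xor-identityˡ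

⊞-identityʳ : (u : 𝔽₂^ n) → u ⊞ 𝟎 ≡ u
⊞-identityʳ u = trans (⊞-comm u 𝟎) (⊞-identityˡ u)

⊞-self : (u : 𝔽₂^ n) → u ⊞ u ≡ 𝟎
⊞-self []      = refl
⊞-self (a ∷ u) = cong₂ _∷_ (xor-same a) (⊞-self u)

⊞-cancel : (u v : 𝔽₂^ n) → u ⊞ (u ⊞ v) ≡ v
⊞-cancel u v = begin
  u ⊞ (u ⊞ v) ≡⟨ ⊞-assoc u u v ⟨
  (u ⊞ u) ⊞ v ≡⟨ cong (_⊞ v) (⊞-self u) ⟩
  𝟎 ⊞ v       ≡⟨ ⊞-identityˡ v ⟩
  v           ∎
  where open ≡-Reasoning

⊞-move : {u v w : 𝔽₂^ n} → u ⊞ v ≡ w → v ≡ u ⊞ w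
⊞-move {u = u} {v} refl = sym (⊞-cancel u v)

⊞-injectiveʳ : (u : 𝔽₂^ n) {v w : 𝔽₂^ n} → u ⊞ v ≡ u ⊞ w → v ≡ w
⊞-injectiveʳ u {w = w} eq = trans (⊞-move eq) (⊞-cancel u w)

⊞≡𝟎 : {u v : 𝔽₂^ n} → u ⊞ v ≡ 𝟎 → u ≡ v
⊞≡𝟎 {u = u} eq = sym (trans (⊞-move eq) (⊞-identityʳ u))

⊞-left-comm : (u v w : 𝔽₂^ n) → u ⊞ (v ⊞ w) ≡ v ⊞ (u ⊞ w)
⊞-left-comm u v w = begin
  u ⊞ (v ⊞ w) ≡⟨ ⊞-assoc u v w ⟨
  u ⊞ v ⊞ w   ≡⟨ cong (_⊞ w) (⊞-comm u v) ⟩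
  v ⊞ u ⊞ w   ≡⟨ ⊞-assoc v u w ⟩
  v ⊞ (u ⊞ w) ∎
  where open ≡-Reasoning

⊞-translate : (u v w : 𝔽₂^ n) → (u ⊞ v) ⊞ (u ⊞ w) ≡ v ⊞ w
⊞-translate u v w = begin
  (u ⊞ v) ⊞ (u ⊞ w) ≡⟨ ⊞-assoc u v (u ⊞ w) ⟩
  u ⊞ (v ⊞ (u ⊞ w)) ≡⟨ cong (u ⊞_) (⊞-left-comm v u w) ⟩
  u ⊞ (u ⊞ (v ⊞ w)) ≡⟨ ⊞-cancel u (v ⊞ w) ⟩
  v ⊞ w             ∎
  where open ≡-Reasoning

nonzero : 𝔽₂^ n → Bool
nonzero []          = false
nonzero (false ∷ v) = nonzero v
nonzero (true ∷ v)  = true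

nonzero-𝟎 : ∀ n → ¬ T (nonzero (𝟎 {n}))
nonzero-𝟎 (suc n) = nonzero-𝟎 n

nonzero⇒≢ : {u v : 𝔽₂^ n} → T (nonzero (u ⊞ v)) → u ≢ v
nonzero⇒≢ {n} {u} t refl = nonzero-𝟎 n (subst (T ∘ nonzero) (⊞-self u) t)

≢⇒nonzero : {u v : 𝔽₂^ n} → u ≢ v → T (nonzero (u ⊞ v))
≢⇒nonzero {u = []}        {[]}        u≢v = u≢v refl
≢⇒nonzero {u = false ∷ u} {false ∷ v} u≢v = ≢⇒nonzero (u≢v ∘ cong (false ∷_))
≢⇒nonzero {u = false ∷ u} {true ∷ v}  u≢v = tt
≢⇒nonzero {u = true ∷ u}  {false ∷ v} u≢v = tt
≢⇒nonzero {u = true ∷ u}  {true ∷ v}  u≢v = ≢⇒nonzero (u≢v ∘ cong (true ∷_))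

-- Subsets of 𝔽₂ⁿ

-- A truth table stored as a binary tree. Trees with the same members are equal, so sets are
-- compared syntactically, and translation and complement act by recursion on the tree.
data Subset : ℕ → Set where
  leaf : Bool → Subset 0
  node : Subset n → Subset n → Subset (suc n)

infix 8 _⟨_⟩

_⟨_⟩ : Subset n → 𝔽₂^ n → Bool
leaf b   ⟨ [] ⟩        = b
node X Y ⟨ false ∷ v ⟩ = X ⟨ v ⟩
node X Y ⟨ true ∷ v ⟩  = Y ⟨ v ⟩

⟨⟩-ext : {X Y : Subset n} → (∀ v → X ⟨ v ⟩ ≡ Y ⟨ v ⟩) → X ≡ Y
⟨⟩-ext {X = leaf _}   {leaf _}     eq = cong leaf (eq [])
⟨⟩-ext {X = node _ _} {node _ _}   eq = cong₂ node (⟨⟩-ext (eq ∘ (false ∷_))) (⟨⟩-ext (eq ∘ (true ∷_)))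

infix 7 _≡ˢ_ _∈ˢ_

_≡ˢ_ : Subset n → Subset n → Bool
leaf false ≡ˢ leaf b     = not b
leaf true  ≡ˢ leaf b     = b
node X Y   ≡ˢ node X′ Y′ = X ≡ˢ X′ ∧ Y ≡ˢ Y′

≡ˢ-sound : {X Y : Subset n} → T (X ≡ˢ Y) → X ≡ Y
≡ˢ-sound {X = leaf false} {leaf false} _ = refl
≡ˢ-sound {X = leaf true}  {leaf true}  _ = refl
≡ˢ-sound {X = node _ _}   {node _ _}   t = case to T-∧ t of λ (p , q) → cong₂ node (≡ˢ-sound p) (≡ˢ-sound q)

_∈ˢ_ : Subset n → List (Subset n) → Bool
X ∈ˢ []       = false
X ∈ˢ (Y ∷ Ys) = X ≡ˢ Y ∨ X ∈ˢ Ys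

∈ˢ-sound : {X : Subset n} (Ys : List (Subset n)) → T (X ∈ˢ Ys) → X ∈ Ys
∈ˢ-sound (Y ∷ Ys) t = [ here ∘ ≡ˢ-sound , there ∘ ∈ˢ-sound Ys ]′ (to T-∨ t)

constant : Bool → Subset n
constant {zero}  b = leaf b
constant {suc n} b = node (constant b) (constant b)

constant-⟨⟩ : ∀ b (v : 𝔽₂^ n) → constant b ⟨ v ⟩ ≡ b
constant-⟨⟩ b []          = refl
constant-⟨⟩ b (false ∷ v) = constant-⟨⟩ b v
constant-⟨⟩ b (true ∷ v)  = constant-⟨⟩ b v

full : Subset n → Bool
full (leaf b)   = b
full (node X Y) = full X ∧ full Y

full-sound : (X : Subset n) → T (full X) → ∀ v → T (X ⟨ v ⟩)
full-sound (leaf _)   t []          = t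
full-sound (node X Y) t (false ∷ v) = full-sound X (proj₁ (to T-∧ t)) v
full-sound (node X Y) t (true ∷ v)  = full-sound Y (proj₂ (to (T-∧ {full X}) t)) v

insert : 𝔽₂^ n → Subset n → Subset n
insert []          (leaf _)   = leaf true
insert (false ∷ v) (node X Y) = node (insert v X) Y
insert (true ∷ v)  (node X Y) = node X (insert v Y)

insert-≡ : (v : 𝔽₂^ n) (X : Subset n) → insert v X ⟨ v ⟩ ≡ true
insert-≡ []          (leaf _)   = refl
insert-≡ (false ∷ v) (node X Y) = insert-≡ v X
insert-≡ (true ∷ v)  (node X Y) = insert-≡ v Y

insert-≢ : {v w : 𝔽₂^ n} (X : Subset n) → w ≢ v → insert v X ⟨ w ⟩ ≡ X ⟨ w ⟩
insert-≢ {v = []}        {[]}        X          w≢v = contradiction refl w≢v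
insert-≢ {v = false ∷ v} {false ∷ w} (node X Y) w≢v = insert-≢ X (w≢v ∘ cong (false ∷_))
insert-≢ {v = false ∷ v} {true ∷ w}  (node X Y) w≢v = refl
insert-≢ {v = true ∷ v}  {false ∷ w} (node X Y) w≢v = refl
insert-≢ {v = true ∷ v}  {true ∷ w}  (node X Y) w≢v = insert-≢ Y (w≢v ∘ cong (true ∷_))

∁ : Subset n → Subset n
∁ (leaf b)   = leaf (not b)
∁ (node X Y) = node (∁ X) (∁ Y)

∁-⟨⟩ : (X : Subset n) (v : 𝔽₂^ n) → ∁ X ⟨ v ⟩ ≡ not (X ⟨ v ⟩)
∁-⟨⟩ (leaf b)   []          = refl
∁-⟨⟩ (node X Y) (false ∷ v) = ∁-⟨⟩ X v
∁-⟨⟩ (node X Y) (true ∷ v)  = ∁-⟨⟩ Y v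

∁-∈ : (X : Subset n) {v : 𝔽₂^ n} → ¬ T (X ⟨ v ⟩) → T (∁ X ⟨ v ⟩)
∁-∈ X {v} v∉X with X ⟨ v ⟩ | ∁-⟨⟩ X v
... | true  | _  = contradiction tt v∉X
... | false | eq = subst T (sym eq) tt

∁-involutive : (X : Subset n) → ∁ (∁ X) ≡ X
∁-involutive (leaf b)   = cong leaf (not-involutive b)
∁-involutive (node X Y) = cong₂ node (∁-involutive X) (∁-involutive Y)

translate : 𝔽₂^ n → Subset n → Subset n
translate []          X          = X
translate (false ∷ v) (node X Y) = node (translate v X) (translate v Y)
translate (true ∷ v)  (node X Y) = node (translate v Y) (translate v X)

translate-⟨⟩ : (u : 𝔽₂^ n) (X : Subset n) (v : 𝔽₂^ n) → translate u X ⟨ v ⟩ ≡ X ⟨ u ⊞ v ⟩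
translate-⟨⟩ []          X          []          = refl
translate-⟨⟩ (false ∷ u) (node X Y) (false ∷ v) = translate-⟨⟩ u X v
translate-⟨⟩ (false ∷ u) (node X Y) (true ∷ v)  = translate-⟨⟩ u Y v
translate-⟨⟩ (true ∷ u)  (node X Y) (false ∷ v) = translate-⟨⟩ u Y v
translate-⟨⟩ (true ∷ u)  (node X Y) (true ∷ v)  = translate-⟨⟩ u X v

elements : Subset n → List (𝔽₂^ n)
elements (leaf false) = []
elements (leaf true)  = [] ∷ []
elements (node X Y)   = map (false ∷_) (elements X) ++ map (true ∷_) (elements Y)

∈-elements : (X : Subset n) {v : 𝔽₂^ n} → T (X ⟨ v ⟩) → v ∈ elements X
∈-elements (leaf true) {[]}       _ = here refl
∈-elements (node X Y) {false ∷ v} t = ∈-++⁺ˡ (∈-map⁺ (false ∷_) (∈-elements X t))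
∈-elements (node X Y) {true ∷ v}  t = ∈-++⁺ʳ (map (false ∷_) (elements X)) (∈-map⁺ (true ∷_) (∈-elements Y t))

elements-∈ : (X : Subset n) {v : 𝔽₂^ n} → v ∈ elements X → T (X ⟨ v ⟩)
elements-∈ (leaf true) (here refl) = tt
elements-∈ (node X Y) v∈ with ∈-++⁻ (map (false ∷_) (elements X)) v∈
... | inj₁ v∈₀ with _ , w∈ , refl ← ∈-map⁻ (false ∷_) v∈₀ = elements-∈ X w∈
... | inj₂ v∈₁ with _ , w∈ , refl ← ∈-map⁻ (true ∷_) v∈₁  = elements-∈ Y w∈

elements-unique : (X : Subset n) → Unique (elements X)
elements-unique (leaf false) = []
elements-unique (leaf true)  = [] ∷ []
elements-unique (node X Y)   =
  Unique.++⁺ (Unique.map⁺ ∷-injectiveʳ (elements-unique X)) (Unique.map⁺ ∷-injectiveʳ (elements-unique Y))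
    λ (v∈₀ , v∈₁) → disjoint (∈-map⁻ (false ∷_) v∈₀) (∈-map⁻ (true ∷_) v∈₁)
  where
  disjoint : ∀ {v xs ys} → (∃ λ x → x ∈ xs × v ≡ false ∷ x) → ¬ (∃ λ y → y ∈ ys × v ≡ true ∷ y)
  disjoint (_ , _ , refl) (_ , _ , ())

size : Subset n → ℕ
size X = length (elements X)

size-∁ : (X : Subset n) → size X + size (∁ X) ≡ 2 ^ n
size-∁ (leaf false)       = refl
size-∁ (leaf true)        = refl
size-∁ {suc n} (node X Y) = begin
  size (node X Y) + size (node (∁ X) (∁ Y))         ≡⟨ cong₂ _+_ (size-node X Y) (size-node (∁ X) (∁ Y)) ⟩
  (size X + size Y) + (size (∁ X) + size (∁ Y))     ≡⟨ interchange (size X) (size Y) (size (∁ X)) (size (∁ Y)) ⟩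
  (size X + size (∁ X)) + (size Y + size (∁ Y))     ≡⟨ cong₂ _+_ (size-∁ X) (size-∁ Y) ⟩
  2 ^ n + 2 ^ n                                     ≡⟨ cong (2 ^ n +_) (+-identityʳ (2 ^ n)) ⟨
  2 ^ suc n                                         ∎
  where
  open ≡-Reasoning
  open CommutativeSemigroupProperties +-commutativeSemigroup using (interchange)
  size-node : ∀ X Y → size (node X Y) ≡ size X + size Y
  size-node X Y = trans (length-++ (map (false ∷_) (elements X)))
                        (cong₂ _+_ (length-map _ (elements X)) (length-map _ (elements Y)))

∈-universe : (v : 𝔽₂^ n) → v ∈ elements (constant true)
∈-universe v = ∈-elements (constant true) (subst T (sym (constant-⟨⟩ true v)) tt)

unique-length≤2^n : {vs : List (𝔽₂^ n)} → Unique vs → length vs ≤ 2 ^ n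
unique-length≤2^n {n} {vs} vs! = begin
  length vs                      ≤⟨ unique-length vs! (λ {v} _ → ∈-universe v) ⟩
  size universe                  ≤⟨ m≤m+n (size universe) (size (∁ universe)) ⟩
  size universe + size (∁ universe) ≡⟨ size-∁ universe ⟩
  2 ^ n                          ∎
  where
  open ≤-Reasoning
  universe : Subset n
  universe = constant true

fromList : List (𝔽₂^ n) → Subset n
fromList = foldr insert (constant false)

fromList-∈ : {v : 𝔽₂^ n} (vs : List (𝔽₂^ n)) → v ∈ vs → T (fromList vs ⟨ v ⟩)
fromList-∈ {v = v} (w ∷ vs) v∈ with v ≟ w | v∈
... | yes refl | _         = subst T (sym (insert-≡ v (fromList vs))) tt
... | no v≢w   | here v≡w  = contradiction v≡w v≢w
... | no v≢w   | there v∈′ = subst T (sym (insert-≢ (fromList vs) v≢w)) (fromList-∈ vs v∈′)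

∈-fromList : {v : 𝔽₂^ n} (vs : List (𝔽₂^ n)) → T (fromList vs ⟨ v ⟩) → v ∈ vs
∈-fromList {v = v} []       t = ⊥-elim (subst T (constant-⟨⟩ false v) t)
∈-fromList {v = v} (w ∷ vs) t with v ≟ w
... | yes v≡w = here v≡w
... | no v≢w  = there (∈-fromList vs (subst T (insert-≢ (fromList vs) v≢w) t))

T-ext : ∀ {a b} → (T a → T b) → (T b → T a) → a ≡ b
T-ext {false} {false} _ _ = refl
T-ext {false} {true}  _ g = ⊥-elim (g tt)
T-ext {true}  {false} f _ = ⊥-elim (f tt)
T-ext {true}  {true}  _ _ = refl

fromList-elements : (X : Subset n) → fromList (elements X) ≡ X
fromList-elements X = ⟨⟩-ext λ v →
  T-ext (elements-∈ X ∘ ∈-fromList (elements X)) (fromList-∈ (elements X) ∘ ∈-elements X)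

-- Affine maps

infixr 7 _·_

linear : Vec (𝔽₂^ n) k → 𝔽₂^ k → 𝔽₂^ n
linear []       []          = 𝟎
linear (m ∷ ms) (false ∷ v) = linear ms v
linear (m ∷ ms) (true ∷ v)  = m ⊞ linear ms v

linear-⊞ : (ms : Vec (𝔽₂^ n) k) (v w : 𝔽₂^ k) → linear ms (v ⊞ w) ≡ linear ms v ⊞ linear ms w
linear-⊞ []       []          []          = sym (⊞-identityˡ 𝟎)
linear-⊞ (m ∷ ms) (false ∷ v) (false ∷ w) = linear-⊞ ms v w
linear-⊞ (m ∷ ms) (false ∷ v) (true ∷ w)  =
  trans (cong (m ⊞_) (linear-⊞ ms v w)) (⊞-left-comm m (linear ms v) (linear ms w))
linear-⊞ (m ∷ ms) (true ∷ v)  (false ∷ w) =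
  trans (cong (m ⊞_) (linear-⊞ ms v w)) (sym (⊞-assoc m (linear ms v) (linear ms w)))
linear-⊞ (m ∷ ms) (true ∷ v)  (true ∷ w)  =
  trans (linear-⊞ ms v w) (sym (⊞-translate m (linear ms v) (linear ms w)))

-- `t` lies in the span of `m ∷ ms` exactly when `t` or `t + m` lies in the span of `ms`.
-- Independence is thus tested by running through all sums of columns instead of by elimination.
misses : 𝔽₂^ n → Vec (𝔽₂^ n) k → Bool
misses t []       = nonzero t
misses t (m ∷ ms) = misses t ms ∧ misses (t ⊞ m) ms

misses-sound : (t : 𝔽₂^ n) (ms : Vec (𝔽₂^ n) k) → T (misses t ms) → ∀ v → t ≢ linear ms v
misses-sound {n} t []   p []          refl = nonzero-𝟎 n p
misses-sound t (m ∷ ms) p (false ∷ v) eq   = misses-sound t ms (proj₁ (to T-∧ p)) v eq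
misses-sound t (m ∷ ms) p (true ∷ v)  eq   =
  misses-sound (t ⊞ m) ms (proj₂ (to (T-∧ {misses t ms}) p)) v
    (trans (⊞-comm t m) (sym (⊞-move (sym eq))))

independent : Vec (𝔽₂^ n) k → Bool
independent []       = true
independent (m ∷ ms) = misses m ms ∧ independent ms

linear-difference : (ms : Vec (𝔽₂^ n) k) {m : 𝔽₂^ n} (v w : 𝔽₂^ k) →
  m ⊞ linear ms v ≡ linear ms w → m ≡ linear ms (v ⊞ w)
linear-difference ms {m} v w eq = begin
  m                         ≡⟨ ⊞-move (trans (⊞-comm (linear ms v) m) eq) ⟩
  linear ms v ⊞ linear ms w ≡⟨ linear-⊞ ms v w ⟨
  linear ms (v ⊞ w)         ∎
  where open ≡-Reasoning

-- A coincidence between a combination that uses the column `m` and one that does not would express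
-- `m` through `ms`, which `misses` excludes.
linear-injective : (ms : Vec (𝔽₂^ n) k) → T (independent ms) → ∀ {v w} → linear ms v ≡ linear ms w → v ≡ w
linear-injective []       p {[]}    {[]}    eq = refl
linear-injective (m ∷ ms) p {a ∷ v} {b ∷ w} eq with to (T-∧ {misses m ms}) p
linear-injective (m ∷ ms) p {false ∷ v} {false ∷ w} eq | _ , q = cong (false ∷_) (linear-injective ms q eq)
linear-injective (m ∷ ms) p {true ∷ v}  {true ∷ w}  eq | _ , q =
  cong (true ∷_) (linear-injective ms q (⊞-injectiveʳ m eq))
linear-injective (m ∷ ms) p {false ∷ v} {true ∷ w}  eq | r , _ =
  contradiction (linear-difference ms w v (sym eq)) (misses-sound m ms r (w ⊞ v))
linear-injective (m ∷ ms) p {true ∷ v}  {false ∷ w} eq | r , _ =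
  contradiction (linear-difference ms v w eq) (misses-sound m ms r (v ⊞ w))

-- A vector missed by the image would make it, together with the image,
-- a repetition-free list longer than the whole space.
linear-surjective : (ms : Vec (𝔽₂^ n) n) → T (independent ms) → ∀ w → ∃[ v ] linear ms v ≡ w
linear-surjective {n} ms p w = decide (w ∈? map (linear ms) universe)
  where
  open import Data.List.Membership.DecPropositional _≟_ using (_∈?_)
  universe : List (𝔽₂^ n)
  universe = elements (constant true)
  image! : Unique (map (linear ms) universe)
  image! = Unique.map⁺ (linear-injective ms p) (elements-unique (constant true))
  decide : Dec (w ∈ map (linear ms) universe) → ∃[ v ] linear ms v ≡ w
  decide (yes w∈) = case ∈-map⁻ (linear ms) w∈ of λ (v , _ , w≡) → v , sym w≡
  decide (no w∉)  = contradiction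
    (unique-length (All.¬Any⇒All¬ _ w∉ ∷ image!) (λ {v} _ → ∈-universe v))
    (<-irrefl (length-map (linear ms) universe))

Affine : ℕ → Set
Affine n = 𝔽₂^ n × Vec (𝔽₂^ n) n

Invertible : Affine n → Bool
Invertible (t , ms) = independent ms

_·_ : Affine n → 𝔽₂^ n → 𝔽₂^ n
(t , ms) · v = t ⊞ linear ms v

-- The reason for affine invariance: if `f` moves `u` and its linear part moves `b` and `c`, the
-- forbidden point `u + (b + c)` is moved by `f`.
·-⊞ : (f : Affine n) (v w₁ w₂ : 𝔽₂^ n) →
  f · (v ⊞ (w₁ ⊞ w₂)) ≡ f · v ⊞ (linear (proj₂ f) w₁ ⊞ linear (proj₂ f) w₂)
·-⊞ (t , ms) v w₁ w₂ = begin
  t ⊞ linear ms (v ⊞ (w₁ ⊞ w₂))                        ≡⟨ cong (t ⊞_) (linear-⊞ ms v (w₁ ⊞ w₂)) ⟩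
  t ⊞ (linear ms v ⊞ linear ms (w₁ ⊞ w₂))              ≡⟨ ⊞-assoc t (linear ms v) _ ⟨
  t ⊞ linear ms v ⊞ linear ms (w₁ ⊞ w₂)                ≡⟨ cong (t ⊞ linear ms v ⊞_) (linear-⊞ ms w₁ w₂) ⟩
  t ⊞ linear ms v ⊞ (linear ms w₁ ⊞ linear ms w₂)      ∎
  where open ≡-Reasoning

·-injective : (f : Affine n) → T (Invertible f) → ∀ {v w} → f · v ≡ f · w → v ≡ w
·-injective (t , ms) p eq = linear-injective ms p (⊞-injectiveʳ t eq)

·-surjective : (f : Affine n) → T (Invertible f) → ∀ w → ∃[ v ] f · v ≡ w
·-surjective (t , ms) p w with v , eq ← linear-surjective ms p (t ⊞ w) =
  v , trans (cong (t ⊞_) eq) (⊞-cancel t w)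

-- Preimages are used in place of images because each leaf is then a single lookup in `X`, and no
-- inverse map has to be computed.
preimage : 𝔽₂^ n → Vec (𝔽₂^ n) k → Subset n → Subset k
preimage t []       X = leaf (X ⟨ t ⟩)
preimage t (m ∷ ms) X = node (preimage t ms X) (preimage (t ⊞ m) ms X)

preimage-⟨⟩ : (t : 𝔽₂^ n) (ms : Vec (𝔽₂^ n) k) (X : Subset n) (v : 𝔽₂^ k) →
  preimage t ms X ⟨ v ⟩ ≡ X ⟨ t ⊞ linear ms v ⟩
preimage-⟨⟩ t []       X []          = cong (X ⟨_⟩) (sym (⊞-identityʳ t))
preimage-⟨⟩ t (m ∷ ms) X (false ∷ v) = preimage-⟨⟩ t ms X v
preimage-⟨⟩ t (m ∷ ms) X (true ∷ v)  =
  trans (preimage-⟨⟩ (t ⊞ m) ms X v) (cong (X ⟨_⟩) (⊞-assoc t m (linear ms v)))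

infix 8 _⁻¹[_]

_⁻¹[_] : Affine n → Subset n → Subset n
(t , ms) ⁻¹[ X ] = preimage t ms X

⁻¹-⟨⟩ : (f : Affine n) (X : Subset n) (v : 𝔽₂^ n) → f ⁻¹[ X ] ⟨ v ⟩ ≡ X ⟨ f · v ⟩
⁻¹-⟨⟩ (t , ms) = preimage-⟨⟩ t ms

⁻¹-∁ : (f : Affine n) (X : Subset n) → f ⁻¹[ ∁ X ] ≡ ∁ (f ⁻¹[ X ])
⁻¹-∁ f X = ⟨⟩-ext λ v → begin
  f ⁻¹[ ∁ X ] ⟨ v ⟩     ≡⟨ ⁻¹-⟨⟩ f (∁ X) v ⟩
  ∁ X ⟨ f · v ⟩         ≡⟨ ∁-⟨⟩ X (f · v) ⟩
  not (X ⟨ f · v ⟩)     ≡⟨ cong not (⁻¹-⟨⟩ f X v) ⟨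
  not (f ⁻¹[ X ] ⟨ v ⟩) ≡⟨ ∁-⟨⟩ (f ⁻¹[ X ]) v ⟨
  ∁ (f ⁻¹[ X ]) ⟨ v ⟩   ∎
  where open ≡-Reasoning

⁻¹-insert : (f : Affine n) → T (Invertible f) → ∀ v X → f ⁻¹[ insert (f · v) X ] ≡ insert v (f ⁻¹[ X ])
⁻¹-insert f f! v X = ⟨⟩-ext λ w → trans (⁻¹-⟨⟩ f (insert (f · v) X) w) (pointwise w)
  where
  pointwise : ∀ w → insert (f · v) X ⟨ f · w ⟩ ≡ insert v (f ⁻¹[ X ]) ⟨ w ⟩
  pointwise w with w ≟ v
  ... | yes refl = trans (insert-≡ (f · v) X) (sym (insert-≡ v (f ⁻¹[ X ])))
  ... | no w≢v   = begin
    insert (f · v) X ⟨ f · w ⟩    ≡⟨ insert-≢ X (w≢v ∘ ·-injective f f!) ⟩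
    X ⟨ f · w ⟩                   ≡⟨ ⁻¹-⟨⟩ f X w ⟨
    f ⁻¹[ X ] ⟨ w ⟩               ≡⟨ insert-≢ (f ⁻¹[ X ]) w≢v ⟨
    insert v (f ⁻¹[ X ]) ⟨ w ⟩    ∎
    where open ≡-Reasoning

IsSymmetry : Subset n → Affine n → Set
IsSymmetry X g = T (Invertible g) × g ⁻¹[ X ] ≡ X

-- Lets the generators stored with a representative serve for its complement too.
∁-symmetry : (X : Subset n) {g : Affine n} → IsSymmetry X g → IsSymmetry (∁ X) g
∁-symmetry X {g} (g! , eq) = g! , trans (⁻¹-∁ g X) (cong ∁ eq)

symmetry-⟨⟩ : {X : Subset n} (g : Affine n) → IsSymmetry X g → ∀ v → X ⟨ g · v ⟩ ≡ X ⟨ v ⟩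
symmetry-⟨⟩ {X = X} g (_ , eq) v = trans (sym (⁻¹-⟨⟩ g X v)) (cong (_⟨ v ⟩) eq)

-- spread k gs vs X adds to X the orbits of vs under gs; points already in X
-- are not propagated, and k bounds the number of steps.
spread : ℕ → List (Affine n) → List (𝔽₂^ n) → Subset n → Subset n
spread k       gs []       X = X
spread zero    gs (v ∷ vs) X = X
spread (suc k) gs (v ∷ vs) X =
  if X ⟨ v ⟩ then spread k gs vs X
  else spread k gs (map (_· v) gs ++ vs) (insert v X)

-- Only members of the result are described, so stopping early for want of fuel is harmless. It is
-- applied with `P` a cap on fibres, when orbits are charged, and with `P` the property of extending
-- a representative by a point.
spread-sound : (P : 𝔽₂^ n → Set) (gs : List (Affine n)) → All (λ g → ∀ {v} → P v → P (g · v)) gs →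
  ∀ k vs X → All P vs → (∀ {v} → T (X ⟨ v ⟩) → P v) → ∀ {v} → T (spread k gs vs X ⟨ v ⟩) → P v
spread-sound P gs closed k       []       X Pvs        PX = PX
spread-sound P gs closed zero    (v ∷ vs) X Pvs        PX = PX
spread-sound P gs closed (suc k) (v ∷ vs) X (Pv ∷ Pvs) PX with X ⟨ v ⟩
... | true  = spread-sound P gs closed k vs X Pvs PX
... | false = spread-sound P gs closed k _ (insert v X)
  (All.++⁺ (All.map⁺ (All.map (λ c → c Pv) closed)) Pvs) PvX
  where
  PvX : ∀ {w} → T (insert v X ⟨ w ⟩) → P w
  PvX {w} t with w ≟ v
  ... | yes refl = Pv
  ... | no w≢v   = PX (subst T (insert-≢ X w≢v) t)

-- Every step removes one queued point. At most `2 ^ n` insertions queue `length gs` points each,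
-- and the remaining `2 ^ n` steps pay for a starting list of up to `2 ^ n` points.
orbits : List (Affine n) → List (𝔽₂^ n) → Subset n → Subset n
orbits {n} gs = spread (2 ^ n * suc (length gs)) gs

-- Configurations

-- A subset S of (ℤ/4)ⁿ is recorded as the list of pairs (u , b) with u + 2b ∈ S,
-- where u and b have entries in {0, 1}; X contains the reductions modulo 2 of S.
record Configuration (X : Subset n) (S : List (𝔽₂^ n × 𝔽₂^ n)) : Set where
  field
    unique    : Unique S
    supported : ∀ {u b} → (u , b) ∈ S → T (X ⟨ u ⟩)
    separated : ∀ {u b c} → (u , b) ∈ S → (u , c) ∈ S → b ≢ c → ¬ T (X ⟨ u ⊞ (b ⊞ c) ⟩)

-- Affine invariance of the bounds.

Bounded : ℕ → Subset n → Set
Bounded N X = ∀ S → Configuration X S → length S ≤ N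

-- The hypothesis is on the preimage because certificates name the map whose preimage is a listed
-- representative.
Invariant : (Subset n → Set) → Set
Invariant Q = ∀ f → T (Invertible f) → ∀ X → Q (f ⁻¹[ X ]) → Q X

-- The pair `(u , b)` is moved by `f` on `u` and by the linear part of `f` on `b`. This differs from
-- a lift of `f` to ℤ/4 by a translation of each fibre, which leaves every `b + c` unchanged.
Bounded-invariant : ∀ N → Invariant (Bounded {n} N)
Bounded-invariant {n} N f@(t , ms) f! X bound S conf = begin
  length S           ≡⟨ length-map back S ⟨
  length (map back S) ≤⟨ bound (map back S) pulled ⟩
  N                  ∎
  where
  open ≤-Reasoning
  open Configuration conf
  forth back : 𝔽₂^ n × 𝔽₂^ n → 𝔽₂^ n × 𝔽₂^ n
  forth (u , b) = f · u , linear ms b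
  back  (u , b) = proj₁ (·-surjective f f! u) , proj₁ (linear-surjective ms f! b)
  forth-back : ∀ p → forth (back p) ≡ p
  forth-back (u , b) = cong₂ _,_ (proj₂ (·-surjective f f! u)) (proj₂ (linear-surjective ms f! b))
  back-injective : ∀ {p q} → back p ≡ back q → p ≡ q
  back-injective {p} {q} eq = trans (sym (forth-back p)) (trans (cong forth eq) (forth-back q))
  forth-∈ : ∀ {p} → p ∈ map back S → forth p ∈ S
  forth-∈ p∈ with q , q∈ , refl ← ∈-map⁻ back p∈ = subst (_∈ S) (sym (forth-back q)) q∈
  pulled : Configuration (f ⁻¹[ X ]) (map back S)
  pulled .Configuration.unique = Unique.map⁺ back-injective unique
  pulled .Configuration.supported {u} p∈ = subst T (sym (⁻¹-⟨⟩ f X u)) (supported (forth-∈ p∈))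
  pulled .Configuration.separated {u} {b} {c} p∈ q∈ b≢c =
    separated (forth-∈ p∈) (forth-∈ q∈) (b≢c ∘ linear-injective ms f!)
      ∘ subst T (trans (⁻¹-⟨⟩ f X (u ⊞ (b ⊞ c))) (cong (X ⟨_⟩) (·-⊞ f u b c)))

record Packing (X : Subset n) (u : 𝔽₂^ n) (B : List (𝔽₂^ n)) : Set where
  field
    unique    : Unique B
    separated : ∀ {b c} → b ∈ B → c ∈ B → b ≢ c → ¬ T (X ⟨ u ⊞ (b ⊞ c) ⟩)

Cap : Subset n → ℕ → 𝔽₂^ n → Set
Cap X m u = ∀ B → Packing X u B → length B ≤ m

-- The linear part of `g` matches packings over `u` with packings over `g · u`, since `g` preserves
-- `X`. One cap therefore serves a whole orbit.
Cap-symmetry : {X : Subset n} (g : Affine n) → IsSymmetry X g → ∀ {m u} → Cap X m u → Cap X m (g · u)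
Cap-symmetry {n} {X} g@(t , ms) sym-g@(g! , _) {m} {u} cap B pack = begin
  length B            ≡⟨ length-map back B ⟨
  length (map back B) ≤⟨ cap (map back B) pulled ⟩
  m                   ∎
  where
  open ≤-Reasoning
  open Packing pack
  back : 𝔽₂^ n → 𝔽₂^ n
  back b = proj₁ (linear-surjective ms g! b)
  linear-back : ∀ b → linear ms (back b) ≡ b
  linear-back b = proj₂ (linear-surjective ms g! b)
  linear-∈ : ∀ {b} → b ∈ map back B → linear ms b ∈ B
  linear-∈ b∈ with c , c∈ , refl ← ∈-map⁻ back b∈ = subst (_∈ B) (sym (linear-back c)) c∈
  pulled : Packing X u (map back B)
  pulled .Packing.unique =
    Unique.map⁺ (λ {b} {c} eq → trans (sym (linear-back b)) (trans (cong (linear ms) eq) (linear-back c))) unique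
  pulled .Packing.separated {b} {c} b∈ c∈ b≢c =
    separated (linear-∈ b∈) (linear-∈ c∈) (b≢c ∘ linear-injective ms g!)
      ∘ subst T (trans (sym (symmetry-⟨⟩ g sym-g (u ⊞ (b ⊞ c)))) (cong (X ⟨_⟩) (·-⊞ g u b c)))

-- Decomposition of a configuration into fibres.

module _ {n} (S : List (𝔽₂^ n × 𝔽₂^ n)) where

  open import Data.List.Membership.DecPropositional (×-≡-dec (_≟_ {n}) (_≟_ {n})) using (_∈?_)

  over? : ∀ u → Decidable (λ b → (u , b) ∈ S)
  over? u b = (u , b) ∈? S

  fibre : 𝔽₂^ n → List (𝔽₂^ n)
  fibre u = filter (over? u) (elements (constant true))

  fibre-∈ : ∀ {u b} → b ∈ fibre u → (u , b) ∈ S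
  fibre-∈ {u} {b} b∈ = proj₂ (∈-filter⁻ (over? u) {v = b} {xs = elements (constant true)} b∈)

  ∈-fibre : ∀ {u b} → (u , b) ∈ S → b ∈ fibre u
  ∈-fibre {u} {b} p∈ = ∈-filter⁺ (over? u) {x = b} {xs = elements (constant true)} (∈-universe b) p∈

  fibre-packing : {X : Subset n} → Configuration X S → ∀ u → Packing X u (fibre u)
  fibre-packing conf u .Packing.unique       = Unique.filter⁺ (over? u) (elements-unique (constant true))
  fibre-packing conf u .Packing.separated b∈ c∈ =
    Configuration.separated conf (fibre-∈ b∈) (fibre-∈ c∈)

  length≤sum-fibres : {X : Subset n} → Configuration X S → length S ≤ sum (map (length ∘ fibre) (elements X))
  length≤sum-fibres {X} conf = begin
    length S                                      ≤⟨ unique-length unique S⊆ ⟩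
    length (concatMap over (elements X))          ≡⟨ length-over (elements X) ⟩
    sum (map (length ∘ fibre) (elements X))       ∎
    where
    open ≤-Reasoning
    open Configuration conf
    over : 𝔽₂^ n → List (𝔽₂^ n × 𝔽₂^ n)
    over u = map (u ,_) (fibre u)
    length-over : ∀ us → length (concatMap over us) ≡ sum (map (length ∘ fibre) us)
    length-over []       = refl
    length-over (u ∷ us) = trans (length-++ (over u)) (cong₂ _+_ (length-map (u ,_) (fibre u)) (length-over us))
    S⊆ : S ⊆ concatMap over (elements X)
    S⊆ {u , b} p∈ =
      ∈-concatMap⁺ over (Any.map (λ { refl → ∈-map⁺ (u ,_) (∈-fibre p∈) }) (∈-elements X (supported p∈)))

infixl 7 _/2^_

_/2^_ : ℕ → ℕ → ℕ
m /2^ n = _/_ m (2 ^ n) {{m^n≢0 2 n}}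

-- Upper bounds for packings

infixl 7 _∩_ _∖_

_∩_ _∖_ : List (𝔽₂^ n) → Subset n → List (𝔽₂^ n)
vs ∩ X = filter (λ v → T? (X ⟨ v ⟩)) vs
vs ∖ X = filter (λ v → ¬? (T? (X ⟨ v ⟩))) vs

-- Branch-and-bound clique search.

short : ℕ → List A → Bool
short zero    xs       = false
short (suc b) []       = true
short (suc b) (x ∷ xs) = short b xs

short-sound : ∀ b (xs : List A) → T (short b xs) → length xs < b
short-sound (suc b) []       _ = s≤s z≤n
short-sound (suc b) (x ∷ xs) t = s≤s (short-sound b xs t)

-- The larger of b and the maximal size of a clique C ⊆ vs, where x and y are
-- adjacent when x + y ∈ D (only an upper bound if the fuel k runs out).
search : Subset n → ℕ → ℕ → List (𝔽₂^ n) → ℕ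
search D k       b []       = b
search D zero    b (x ∷ vs) = b ⊔ suc (length vs)
search D (suc k) b (x ∷ vs) =
  if short b vs then b else
  search D k (b ⊔ suc (search D k (pred b) (vs ∩ translate x D))) vs

search-≥ : ∀ (D : Subset n) k b vs → b ≤ search D k b vs
search-≥ D k       b []       = ≤-refl
search-≥ D zero    b (x ∷ vs) = m≤m⊔n b _
search-≥ D (suc k) b (x ∷ vs) with short b vs
... | true  = ≤-refl
... | false = ≤-trans (m≤m⊔n b _) (search-≥ D k _ vs)

Clique : Subset n → List (𝔽₂^ n) → Set
Clique D C = Unique C × (∀ {x y} → x ∈ C → y ∈ C → x ≢ y → T (D ⟨ x ⊞ y ⟩))

-- A clique without `x` lies in the tail. A clique with `x` is `x` together with a clique among its
-- neighbours, where the floor drops to `pred b` because `x` is already counted.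
search-sound : ∀ (D : Subset n) k b vs {C} → Clique D C → C ⊆ vs → length C ≤ search D k b vs
search-sound D k       b []       {[]}    cl C⊆ = z≤n
search-sound D k       b []       {x ∷ C} cl C⊆ = case C⊆ (here refl) of λ ()
search-sound D zero    b (x ∷ vs) cl C⊆ = ≤-trans (unique-length (proj₁ cl) C⊆) (m≤n⊔m b _)
search-sound {n} D (suc k) b (x ∷ vs) {C} cl@(C! , adj) C⊆ with short b vs in eq
-- Here `suc (length vs) ≤ b`, so nothing inside `x ∷ vs` can exceed the floor.
... | true  = ≤-trans (unique-length C! C⊆) (short-sound b vs (subst T (sym eq) tt))
... | false with x ∈? C
  where open import Data.List.Membership.DecPropositional (_≟_ {n}) using (_∈?_)
... | no x∉C  = search-sound D k _ vs cl λ {y} y∈ → case C⊆ y∈ of λ where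
      (here refl) → contradiction y∈ x∉C
      (there y∈′) → y∈′
... | yes x∈C = begin
  length C                     ≤⟨ unique-length C! C⊆x∷C′ ⟩
  suc (length C′)              ≤⟨ s≤s (search-sound D k (pred b) vs′ (C′! , adj′) C′⊆) ⟩
  suc r                        ≤⟨ m≤n⊔m b (suc r) ⟩
  b ⊔ suc r                    ≤⟨ search-≥ D k (b ⊔ suc r) vs ⟩
  search D k (b ⊔ suc r) vs    ∎
  where
  open ≤-Reasoning
  C′ : List (𝔽₂^ n)
  C′ = filter (λ y → ¬? (y ≟ x)) C
  C′! : Unique C′
  C′! = Unique.filter⁺ (λ y → ¬? (y ≟ x)) C!
  vs′ : List (𝔽₂^ n)
  vs′ = vs ∩ translate x D
  r : ℕ
  r = search D k (pred b) vs′
  ∈C′ : ∀ {y} → y ∈ C′ → y ∈ C × y ≢ x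
  ∈C′ = ∈-filter⁻ (λ y → ¬? (y ≟ x)) {xs = C}
  C⊆x∷C′ : C ⊆ x ∷ C′
  C⊆x∷C′ {y} y∈ with y ≟ x
  ... | yes y≡x = here y≡x
  ... | no y≢x  = there (∈-filter⁺ (λ y → ¬? (y ≟ x)) y∈ y≢x)
  adj′ : ∀ {y z} → y ∈ C′ → z ∈ C′ → y ≢ z → T (D ⟨ y ⊞ z ⟩)
  adj′ y∈ z∈ = adj (proj₁ (∈C′ y∈)) (proj₁ (∈C′ z∈))
  C′⊆ : C′ ⊆ vs ∩ translate x D
  C′⊆ {y} y∈ with ∈C′ y∈
  ... | y∈C , y≢x with C⊆ y∈C
  ...   | here y≡x   = contradiction y≡x y≢x
  ...   | there y∈vs = ∈-filter⁺ (λ v → T? (translate x D ⟨ v ⟩)) y∈vs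
          (subst T (sym (translate-⟨⟩ x D y)) (adj x∈C y∈C (≢-sym y≢x)))

-- A packing may be translated so that it contains 0; its other elements then
-- form a clique for D.
fine : ℕ → Subset n → 𝔽₂^ n → ℕ
fine {n} b X u = suc (search D (2 ^ n) (pred b) (elements D))
  where
  D : Subset n
  D = translate u (∁ X)

fine-sound : ∀ b (X : Subset n) u → Cap X (fine b X u) u
fine-sound b X u []      pack = z≤n
fine-sound {n} b X u (c ∷ B) pack = s≤s (begin
  length B            ≡⟨ length-map (c ⊞_) B ⟨
  length (map (c ⊞_) B) ≤⟨ search-sound D (2 ^ n) (pred b) (elements D) clique ⊆D ⟩
  search D (2 ^ n) (pred b) (elements D) ∎)
  where
  open ≤-Reasoning
  open Packing pack
  D : Subset n
  D = translate u (∁ X)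
  c⊞-injective : ∀ {x y} → c ⊞ x ≡ c ⊞ y → x ≡ y
  c⊞-injective = ⊞-injectiveʳ c
  ∈D : ∀ {x y} → x ∈ c ∷ B → y ∈ c ∷ B → x ≢ y → T (D ⟨ x ⊞ y ⟩)
  ∈D {x} {y} x∈ y∈ x≢y = subst T (sym (translate-⟨⟩ u (∁ X) (x ⊞ y))) (∁-∈ X (separated x∈ y∈ x≢y))
  clique : Clique D (map (c ⊞_) B)
  clique = Unique.map⁺ c⊞-injective (case unique of λ { (_ ∷ B!) → B! }) , adjacent
    where
    adjacent : ∀ {x y} → x ∈ map (c ⊞_) B → y ∈ map (c ⊞_) B → x ≢ y → T (D ⟨ x ⊞ y ⟩)
    adjacent x∈ y∈ x≢y with ∈-map⁻ (c ⊞_) x∈ | ∈-map⁻ (c ⊞_) y∈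
    ... | x , x∈B , refl | y , y∈B , refl =
      subst (T ∘ (D ⟨_⟩)) (sym (⊞-translate c x y)) (∈D (there x∈B) (there y∈B) (x≢y ∘ cong (c ⊞_)))
  ⊆D : map (c ⊞_) B ⊆ elements D
  ⊆D x∈ with x , x∈B , refl ← ∈-map⁻ (c ⊞_) x∈ =
    ∈-elements D (∈D (here refl) (there x∈B) (All.lookup (case unique of λ { (c∉ ∷ _) → c∉ }) x∈B))

-- Bounds from disjoint translates.

punctured : Subset n → Subset n
punctured (leaf _)   = leaf false
punctured (node X Y) = node (punctured X) Y

punctured-⊆ : (X : Subset n) {v : 𝔽₂^ n} → T (punctured X ⟨ v ⟩) → T (X ⟨ v ⟩) × v ≢ 𝟎
punctured-⊆ (leaf _)   {[]}        ()
punctured-⊆ (node X Y) {false ∷ v} t =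
  case punctured-⊆ X t of λ (v∈X , v≢𝟎) → v∈X , v≢𝟎 ∘ ∷-injectiveʳ
punctured-⊆ (node X Y) {true ∷ v}  t = t , λ ()

-- Y is the set of differences which do not occur in a packing B.  If Y contains
-- x, y and x + y then the four translates of B by 0, x, y, x + y are disjoint,
-- and if Y contains x at least B and B + x are.
translationBound : Subset n → List (𝔽₂^ n) → ℕ
translationBound {n} Y []               = 2 ^ n
translationBound {n} Y (x ∷ [])         = 2 ^ n / 2
translationBound {n} Y (x ∷ ys@(_ ∷ _)) =
  if any (λ y → Y ⟨ x ⊞ y ⟩) ys then 2 ^ n / 4 else translationBound Y ys

Avoids : List (𝔽₂^ n) → 𝔽₂^ n → Set
Avoids B x = ∀ {b c} → b ∈ B → c ∈ B → b ⊞ c ≢ x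

double : 𝔽₂^ n → List (𝔽₂^ n) → List (𝔽₂^ n)
double x B = B ++ map (x ⊞_) B

double-unique : ∀ {B : List (𝔽₂^ n)} x → Avoids B x → Unique B → Unique (double x B)
double-unique x avoids B! = Unique.++⁺ B! (Unique.map⁺ (⊞-injectiveʳ x) B!) λ (v∈B , v∈x⊞B) →
  case ∈-map⁻ (x ⊞_) v∈x⊞B of λ where
    (c , c∈B , refl) → avoids c∈B v∈B (trans (⊞-left-comm c x c) (trans (cong (x ⊞_) (⊞-self c)) (⊞-identityʳ x)))

-- Differences inside the union of `B` and `x + B` are differences of `B`, possibly shifted by `x`;
-- such a difference equals `y` only if `y` or `x + y` is a difference of `B`.
double-avoids : ∀ {B : List (𝔽₂^ n)} {x y} → Avoids B y → Avoids B (x ⊞ y) → Avoids (double x B) y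
double-avoids {B = B} {x} y∉ x⊞y∉ b∈ c∈ eq with ∈-++⁻ B b∈ | ∈-++⁻ B c∈
... | inj₁ b∈B | inj₁ c∈B = y∉ b∈B c∈B eq
... | inj₁ b∈B | inj₂ c∈x with c , c∈B , refl ← ∈-map⁻ (x ⊞_) c∈x =
  x⊞y∉ b∈B c∈B (⊞-move (trans (⊞-left-comm x _ c) eq))
... | inj₂ b∈x | inj₁ c∈B with b , b∈B , refl ← ∈-map⁻ (x ⊞_) b∈x =
  x⊞y∉ b∈B c∈B (⊞-move (trans (sym (⊞-assoc x b _)) eq))
... | inj₂ b∈x | inj₂ c∈x with b , b∈B , refl ← ∈-map⁻ (x ⊞_) b∈x | c , c∈B , refl ← ∈-map⁻ (x ⊞_) c∈x =
  y∉ b∈B c∈B (trans (sym (⊞-translate x b c)) eq)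

length-double : ∀ (x : 𝔽₂^ n) B → length (double x B) ≡ length B * 2
length-double x B = begin
  length (double x B)                 ≡⟨ length-++ B ⟩
  length B + length (map (x ⊞_) B)    ≡⟨ cong (length B +_) (length-map (x ⊞_) B) ⟩
  length B + length B                 ≡⟨ cong (length B +_) (+-identityʳ (length B)) ⟨
  2 * length B                        ≡⟨ *-comm 2 (length B) ⟩
  length B * 2                        ∎
  where open ≡-Reasoning

translationBound-sound : ∀ (Y : Subset n) {B} → Unique B → (∀ {x} → T (Y ⟨ x ⟩) → Avoids B x) →
  ∀ xs → All (λ x → T (Y ⟨ x ⟩)) xs → length B ≤ translationBound Y xs
translationBound-sound     Y     B! avoids []               []         = unique-length≤2^n B!
translationBound-sound {n} Y {B} B! avoids (x ∷ [])         (x∈Y ∷ []) = begin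
  length B                ≡⟨ m*n/n≡m (length B) 2 ⟨
  length B * 2 / 2        ≡⟨ cong (_/ 2) (length-double x B) ⟨
  length (double x B) / 2 ≤⟨ /-monoˡ-≤ 2 (unique-length≤2^n (double-unique x (avoids x∈Y) B!)) ⟩
  2 ^ n / 2               ∎
  where open ≤-Reasoning
translationBound-sound {n} Y {B} B! avoids (x ∷ ys@(_ ∷ _)) (x∈Y ∷ ys∈Y) with any (λ y → Y ⟨ x ⊞ y ⟩) ys in eq
... | false = translationBound-sound Y B! avoids ys ys∈Y
... | true with y , y∈ys , x⊞y∈Y ← find (Any.any⁻ (λ y → Y ⟨ x ⊞ y ⟩) ys (subst T (sym eq) tt)) = begin
  length B                           ≡⟨ m*n/n≡m (length B) 4 ⟨
  length B * 4 / 4                   ≡⟨ cong (_/ 4) (*-assoc (length B) 2 2) ⟨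
  length B * 2 * 2 / 4               ≡⟨ cong (λ m → m * 2 / 4) (length-double x B) ⟨
  length (double x B) * 2 / 4        ≡⟨ cong (_/ 4) (length-double y (double x B)) ⟨
  length (double y (double x B)) / 4 ≤⟨ /-monoˡ-≤ 4 (unique-length≤2^n (double-unique y double-avoids-y double-x!)) ⟩
  2 ^ n / 4                          ∎
  where
  open ≤-Reasoning
  double-x! : Unique (double x B)
  double-x! = double-unique x (avoids x∈Y) B!
  double-avoids-y : Avoids (double x B) y
  double-avoids-y = double-avoids (avoids (All.lookup ys∈Y y∈ys)) (avoids x⊞y∈Y)

-- `Y` is the connection set of the Cayley graph. The origin is removed since every element of a
-- packing has difference `𝟎` with itself.
coarse : Subset n → 𝔽₂^ n → ℕ
coarse X u = translationBound Y (elements Y)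
  where Y = punctured (translate u X)

coarse-sound : (X : Subset n) → ∀ u → Cap X (coarse X u) u
coarse-sound X u B pack = translationBound-sound Y unique avoids (elements Y) (All.tabulate (elements-∈ Y))
  where
  open Packing pack
  Y = punctured (translate u X)
  avoids : ∀ {x} → T (Y ⟨ x ⟩) → Avoids B x
  avoids {x} x∈Y {b} {c} b∈ c∈ refl with punctured-⊆ (translate u X) x∈Y
  ... | x∈ , x≢𝟎 = separated b∈ c∈ (λ { refl → x≢𝟎 (⊞-self b) }) (subst T (translate-⟨⟩ u X x) x∈)

-- Sums c over vs, charging every point of an orbit under gs the value of c at
-- the first point of that orbit.
budget : (𝔽₂^ n → ℕ) → List (Affine n) → ℕ → List (𝔽₂^ n) → ℕ
charge : (𝔽₂^ n → ℕ) → List (Affine n) → ℕ → 𝔽₂^ n → List (𝔽₂^ n) → Subset n → ℕ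
budget c gs k       []       = 0
budget c gs zero    (u ∷ us) = sum (map c (u ∷ us))
budget c gs (suc k) (u ∷ us) = charge c gs k u us (orbits gs (u ∷ []) (constant false))
charge c gs k u us O = suc (length (us ∩ O)) * c u + budget c gs k (us ∖ O)

sum-split : ∀ (f : 𝔽₂^ n → ℕ) vs X → sum (map f vs) ≡ sum (map f (vs ∩ X)) + sum (map f (vs ∖ X))
sum-split f []       X = refl
sum-split f (v ∷ vs) X with X ⟨ v ⟩
... | true  = trans (cong (f v +_) (sum-split f vs X)) (sym (+-assoc (f v) _ _))
... | false = begin
  f v + sum (map f vs) ≡⟨ cong (f v +_) (sum-split f vs X) ⟩
  f v + (p + q)        ≡⟨ +-assoc (f v) p q ⟨
  f v + p + q          ≡⟨ cong (_+ q) (+-comm (f v) p) ⟩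
  p + f v + q          ≡⟨ +-assoc p (f v) q ⟩
  p + (f v + q)        ∎
  where
  open ≡-Reasoning
  p = sum (map f (vs ∩ X))
  q = sum (map f (vs ∖ X))

sum-≤ : ∀ {f : A → ℕ} {m vs} → All (λ v → f v ≤ m) vs → sum (map f vs) ≤ length vs * m
sum-≤ []           = z≤n
sum-≤ (fv≤ ∷ fvs≤) = +-mono-≤ fv≤ (sum-≤ fvs≤)

sum-mono : ∀ {f g : A → ℕ} vs → (∀ v → f v ≤ g v) → sum (map f vs) ≤ sum (map g vs)
sum-mono []       f≤g = z≤n
sum-mono (v ∷ vs) f≤g = +-mono-≤ (f≤g v) (sum-mono vs f≤g)

module _ {X : Subset n} {c : 𝔽₂^ n → ℕ} (c-cap : ∀ v → Cap X (c v) v)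
         {gs : List (Affine n)} (gs-sym : All (IsSymmetry X) gs)
         {f : 𝔽₂^ n → ℕ} (f-cap : ∀ {m v} → Cap X m v → f v ≤ m) where

  budget-sound : ∀ k us → sum (map f us) ≤ budget c gs k us
  charge-sound : ∀ k u us O → (∀ {v} → T (O ⟨ v ⟩) → Cap X (c u) v) →
    f u + sum (map f us) ≤ charge c gs k u us O
  budget-sound k       []       = z≤n
  budget-sound zero    (u ∷ us) = sum-mono (u ∷ us) (λ v → f-cap (c-cap v))
  budget-sound (suc k) (u ∷ us) = charge-sound k u us (orbits gs (u ∷ []) (constant false))
    -- Having the cap `c u` is closed under the symmetries, so it passes from `u` to every point of
    -- the computed orbit.
    (spread-sound (Cap X (c u)) gs (All.map (λ {g} g-sym {v} → Cap-symmetry g g-sym {u = v}) gs-sym)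
      (2 ^ n * suc (length gs)) (u ∷ []) (constant false)
      (c-cap u ∷ []) λ {v} t → ⊥-elim (subst T (constant-⟨⟩ false v) t))
  charge-sound k u us O O-cap = begin
    f u + sum (map f us)     ≡⟨ cong (f u +_) (sum-split f us O) ⟩
    f u + (inside + outside) ≡⟨ +-assoc (f u) inside outside ⟨
    f u + inside + outside   ≤⟨ +-mono-≤ (sum-≤ paid) (budget-sound k (us ∖ O)) ⟩
    charge c gs k u us O     ∎
    where
    open ≤-Reasoning
    inside outside : ℕ
    inside  = sum (map f (us ∩ O))
    outside = sum (map f (us ∖ O))
    paid : All (λ v → f v ≤ c u) (u ∷ us ∩ O)
    paid = f-cap (c-cap u) ∷ All.tabulate λ v∈ →
      f-cap (O-cap (proj₂ (∈-filter⁻ (λ v → T? (O ⟨ v ⟩)) {xs = us} v∈)))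

-- Bounding the configurations of a single set X.

within : ℕ → (𝔽₂^ n → ℕ) → List (Affine n) → Subset n → Bool
within N c gs X = budget c gs (size X) (elements X) ≤ᵇ N

within-sound : ∀ {N c gs} {X : Subset n} → (∀ v → Cap X (c v) v) → All (IsSymmetry X) gs →
  T (within N c gs X) → Bounded N X
within-sound {N = N} {X = X} c-cap gs-sym t S conf = begin
  length S                                    ≤⟨ length≤sum-fibres S conf ⟩
  sum (map (length ∘ fibre S) (elements X))   ≤⟨ budget-sound c-cap gs-sym fibre-≤ (size X) (elements X) ⟩
  budget _ _ (size X) (elements X)            ≤⟨ ≤ᵇ⇒≤ _ N t ⟩
  N                                           ∎
  where
  open ≤-Reasoning
  fibre-≤ : ∀ {m u} → Cap X m u → length (fibre S u) ≤ m
  fibre-≤ {u = u} cap = cap (fibre S u) (fibre-packing S conf u)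

-- The disjunction stops at the first bound that succeeds, and the cheap one comes first. The first
-- argument of `fine` is a floor under which fibres are not resolved: roughly the average share of a
-- point of `X`, where pruning is strongest (`suc` also keeps the divisor nonzero), and then
-- `N /2^ n`, no larger unless `X` is everything, so that small fibres can compensate for large
-- ones.
good : ℕ → List (Affine n) → Subset n → Bool
good {n} N gs X =
  within N (coarse X) gs X ∨ within N (fine (N / suc (size X)) X) gs X ∨ within N (fine (N /2^ n) X) gs X

good-sound : ∀ {N gs} {X : Subset n} → All (IsSymmetry X) gs → T (good N gs X) → Bounded N X
good-sound {n} {N} {gs} {X} gs-sym t with to (T-∨ {within N (coarse X) gs X}) t
... | inj₁ t₁ = within-sound (coarse-sound X) gs-sym t₁
... | inj₂ t′ with to (T-∨ {within N (fine (N / suc (size X)) X) gs X}) t′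
...   | inj₁ t₂ = within-sound (fine-sound (N / suc (size X)) X) gs-sym t₂
...   | inj₂ t₃ = within-sound (fine-sound (N /2^ n) X) gs-sym t₃

-- Classification of subsets up to affine equivalence

-- An elimination principle standing for "every set of size `j` is affinely equivalent to a member
-- of `Rs`". Quantifying over invariant properties lets levels be chained without composing or
-- inverting affine maps.
Covers : ℕ → List (Subset n) → Set₁
Covers {n} j Rs = (Q : Subset n → Set) → Invariant Q → (∀ {R} → R ∈ Rs → Q R) →
  ∀ vs → Unique vs → length vs ≡ j → Q (fromList vs)

covers-∅ : {Rs : List (Subset n)} → constant false ∈ Rs → Covers 0 Rs
covers-∅ ∅∈Rs Q Q-inv Q-Rs [] _ _ = Q-Rs ∅∈Rs

-- extensions lists pairs (x , f) such that f⁻¹(set ∪ {x}) is a representative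
-- one size up; together with its images under the stabiliser generators every
-- point outside set occurs.
record Representative (n : ℕ) : Set where
  constructor representative
  field
    set        : Subset n
    symmetries : List (Affine n)
    extensions : List (𝔽₂^ n × Affine n)

open Representative

isSymmetry : Subset n → Affine n → Bool
isSymmetry X g = Invertible g ∧ g ⁻¹[ X ] ≡ˢ X

isSymmetry-sound : (X : Subset n) (g : Affine n) → T (isSymmetry X g) → IsSymmetry X g
isSymmetry-sound X g t = case to (T-∧ {Invertible g}) t of λ (g! , eq) → g! , ≡ˢ-sound eq

symmetric : Representative n → Bool
symmetric r = all (isSymmetry (set r)) (symmetries r)

symmetric-sound : (r : Representative n) → T (symmetric r) → All (IsSymmetry (set r)) (symmetries r)
symmetric-sound r t = All.map (λ {g} → isSymmetry-sound (set r) g) (All.all⁺ _ (symmetries r) t)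

extends : List (Subset n) → Subset n → 𝔽₂^ n × Affine n → Bool
extends Rs R (x , f) = Invertible f ∧ f ⁻¹[ insert x R ] ∈ˢ Rs

extensible : List (Subset n) → Representative n → Bool
extensible Rs r =
  all (extends Rs (set r)) (extensions r) ∧ full (orbits (symmetries r) (map proj₁ (extensions r)) (set r))

-- The preimage of `R ∪ {g · v}` under a symmetry `g` of `R` is `R ∪ {v}`. So the property spreads
-- from the listed points along their orbits, which by `full` exhaust everything outside `R`.
extensible-sound : {Rs : List (Subset n)} (r : Representative n) → T (symmetric r) → T (extensible Rs r) →
  (Q : Subset n → Set) → Invariant Q → (∀ {R} → R ∈ Rs → Q R) →
  ∀ v → ¬ T (set r ⟨ v ⟩) → Q (insert v (set r))
extensible-sound {n} {Rs} r@(representative R gs es) t-sym t-ext Q Q-inv Q-Rs v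
  with to (T-∧ {all (extends Rs R) es}) t-ext
... | t-es , t-full =
  spread-sound P gs (All.map (λ {g} → closed g) (symmetric-sound r t-sym))
    (2 ^ n * suc (length gs)) (map proj₁ es) R
    (All.map⁺ (All.map (λ {e} → base e) (All.all⁺ (extends Rs R) es t-es)))
    -- The orbits are accumulated on top of `R` itself, where `P` holds vacuously.
    (λ t v∉R → contradiction t v∉R)
    (full-sound (orbits gs (map proj₁ es) R) t-full v)
  where
  P : 𝔽₂^ n → Set
  P v = ¬ T (R ⟨ v ⟩) → Q (insert v R)
  closed : ∀ g → IsSymmetry R g → ∀ {v} → P v → P (g · v)
  closed g g-sym@(g! , g⁻¹R≡R) {v} Pv g·v∉R = Q-inv g g! (insert (g · v) R) (subst Q
    (sym (trans (⁻¹-insert g g! v R) (cong (insert v) g⁻¹R≡R)))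
    (Pv (g·v∉R ∘ subst T (sym (symmetry-⟨⟩ g g-sym v)))))
  base : ∀ e → T (extends Rs R e) → P (proj₁ e)
  base (x , f) t _ = case to (T-∧ {Invertible f}) t of λ (f! , f⁻¹∈) →
    Q-inv f f! (insert x R) (Q-Rs (∈ˢ-sound Rs f⁻¹∈))

Level : ℕ → Set
Level n = List (Representative n)

-- The covering for size `j` is applied to `Q′`, that adding any new point yields `Q`. This is again
-- invariant, so it has to be established only for the listed representatives, which
-- `extensible-sound` does.
covers-step : ∀ {j} {rs : Level n} {Rs : List (Subset n)} →
  All (T ∘ symmetric) rs → All (T ∘ extensible Rs) rs → Covers j (map set rs) → Covers (suc j) Rs
covers-step {n} {j} {rs} {Rs} rs-sym rs-ext covers Q Q-inv Q-Rs (v ∷ vs) (v∉vs ∷ vs!) len =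
  covers Q′ Q′-inv Q′-rs vs vs! (suc-injective len) v
    (λ t → contradiction refl (All.lookup v∉vs (∈-fromList vs t)))
  where
  Q′ : Subset n → Set
  Q′ X = ∀ v → ¬ T (X ⟨ v ⟩) → Q (insert v X)
  Q′-inv : Invariant Q′
  Q′-inv f f! X Q′X w w∉X with v , refl ← ·-surjective f f! w =
    Q-inv f f! (insert w X) (subst Q (sym (⁻¹-insert f f! v X)) (Q′X v (w∉X ∘ subst T (⁻¹-⟨⟩ f X v))))
  Q′-rs : ∀ {R} → R ∈ map set rs → Q′ R
  Q′-rs R∈ with r , r∈rs , refl ← ∈-map⁻ set R∈ =
    extensible-sound r (All.lookup rs-sym r∈rs) (All.lookup rs-ext r∈rs) Q Q-inv Q-Rs

bounded-∁-invariant : ∀ N → Invariant {n} (λ X → Bounded N (∁ X))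
bounded-∁-invariant N f f! X bound =
  Bounded-invariant N f f! (∁ X) (subst (Bounded N) (sym (⁻¹-∁ f X)) bound)

-- Checking a chain of levels.

verify : ℕ → Representative n → Bool
verify N r = symmetric r ∧ good N (symmetries r) (set r)

verify-∁ : ℕ → List (Subset n) → Representative n → Bool
verify-∁ N Rs r = good N (symmetries r) (∁ (set r)) ∧ extensible Rs r

chain : ℕ → Level n → List (Level n) → Bool
chain N rs []         = all (verify N) rs
chain N rs (rs′ ∷ ls) = all (verify N) rs ∧ all (verify-∁ N (map set rs′)) rs ∧ chain N rs′ ls

module _ {N : ℕ} where

  verified : (rs : Level n) → T (all (verify N) rs) →
    All (T ∘ symmetric) rs × (∀ {R} → R ∈ map set rs → Bounded N R)
  verified rs t = All.map (λ {r} → proj₁ ∘ split r) ts , λ R∈ → bound (∈-map⁻ set R∈)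
    where
    ts : All (T ∘ verify N) rs
    ts = All.all⁺ (verify N) rs t
    split : ∀ r → T (verify N r) → T (symmetric r) × T (good N (symmetries r) (set r))
    split r = to (T-∧ {symmetric r})
    bound : ∀ {R} → (∃ λ r → r ∈ rs × R ≡ set r) → Bounded N R
    bound (r , r∈rs , refl) with t-sym , t-good ← split r (All.lookup ts r∈rs) =
      good-sound {gs = symmetries r} (symmetric-sound r t-sym) t-good

  verified-∁ : (rs : Level n) {Rs : List (Subset n)} → All (T ∘ symmetric) rs → T (all (verify-∁ N Rs) rs) →
    All (T ∘ extensible Rs) rs × (∀ {R} → R ∈ map set rs → Bounded N (∁ R))
  verified-∁ rs {Rs} rs-sym t = All.map (λ {r} → proj₂ ∘ split r) ts , λ R∈ → bound (∈-map⁻ set R∈)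
    where
    ts : All (T ∘ verify-∁ N Rs) rs
    ts = All.all⁺ (verify-∁ N Rs) rs t
    split : ∀ r → T (verify-∁ N Rs r) → T (good N (symmetries r) (∁ (set r))) × T (extensible Rs r)
    split r = to (T-∧ {good N (symmetries r) (∁ (set r))})
    bound : ∀ {R} → (∃ λ r → r ∈ rs × R ≡ set r) → Bounded N (∁ R)
    bound (r , r∈rs , refl) =
      good-sound (All.map (λ {g} → ∁-symmetry (set r) {g}) (symmetric-sound r (All.lookup rs-sym r∈rs)))
                 (proj₁ (split r (All.lookup ts r∈rs)))

  -- The second inequality is strict because, when `2 ^ n ≤ m + m`, a set with more than `m`
  -- elements has a complement with fewer than `m`. Accordingly `chain` tests complements at every
  -- level but the last.
  BoundedUpTo : ℕ → List (𝔽₂^ n) → Set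
  BoundedUpTo m vs =
    (length vs ≤ m → Bounded N (fromList vs)) × (length vs < m → Bounded N (∁ (fromList vs)))

  chain-sound : ∀ (rs : Level n) ls {j} → T (chain N rs ls) → Covers j (map set rs) →
    {vs : List (𝔽₂^ n)} → Unique vs → j ≤ length vs → BoundedUpTo (j + length ls) vs
  chain-sound rs [] {j} t covers {vs} vs! j≤ =
    (λ ≤j → bound (≤-antisym (≤j+0 ≤j) j≤)) , (λ <j → contradiction j≤ (<⇒≱ (≤j+0 <j)))
    where
    ≤j+0 : ∀ {i} → i ≤ j + 0 → i ≤ j
    ≤j+0 {i} = subst (i ≤_) (+-identityʳ j)
    bound : length vs ≡ j → Bounded N (fromList vs)
    bound = covers (Bounded N) (Bounded-invariant N) (proj₂ (verified rs t)) vs vs!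
  chain-sound rs (rs′ ∷ ls) {j} t covers {vs} vs! j≤
    with t₁ , t′ ← to (T-∧ {all (verify N) rs}) t
    with t₂ , t₃ ← to (T-∧ {all (verify-∁ N (map set rs′)) rs}) t′
    with rs-sym , bound ← verified rs t₁
    with rs-ext , bound-∁ ← verified-∁ rs {map set rs′} rs-sym t₂
    with m≤n⇒m<n∨m≡n j≤
  ... | inj₂ j≡ =
    (λ _ → covers (Bounded N) (Bounded-invariant N) bound vs vs! (sym j≡)) ,
    (λ _ → covers (λ X → Bounded N (∁ X)) (bounded-∁-invariant N) bound-∁ vs vs! (sym j≡))
  ... | inj₁ j< = subst (λ m → BoundedUpTo m vs) (sym (+-suc j (length ls)))
    (chain-sound rs′ ls t₃ (covers-step {Rs = map set rs′} rs-sym rs-ext covers) vs! j<)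

-- The levels treat the sizes 0, …, 2ⁿ⁻¹; larger sets are reached as complements.
certifies : ℕ → List (Level n) → Bool
certifies     N []        = false
certifies {n} N (rs ∷ ls) = constant false ∈ˢ map set rs ∧ (2 ^ n ≤ᵇ length ls + length ls) ∧ chain N rs ls

certifies-sound : ∀ {N} (ls : List (Level n)) → T (certifies N ls) → (X : Subset n) → Bounded N X
certifies-sound {n} {N} (rs ∷ ls) t X
  with t₁ , t′ ← to (T-∧ {constant false ∈ˢ map set rs}) t
  with t₂ , t₃ ← to (T-∧ {2 ^ n ≤ᵇ length ls + length ls}) t′
  = decide (size X ≤? m)
  where
  m : ℕ
  m = length ls
  sound : {vs : List (𝔽₂^ n)} → Unique vs → BoundedUpTo m vs
  sound vs! = chain-sound rs ls t₃ (covers-∅ (∈ˢ-sound (map set rs) t₁)) vs! z≤n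
  decide : Dec (size X ≤ m) → Bounded N X
  decide (yes small) = subst (Bounded N) (fromList-elements X) (proj₁ (sound (elements-unique X)) small)
  decide (no large)  = subst (Bounded N) (trans (cong ∁ (fromList-elements (∁ X))) (∁-involutive X))
    (proj₂ (sound (elements-unique (∁ X))) (+-cancelˡ-< m (size (∁ X)) m (begin-strict
      m + size (∁ X)      <⟨ +-monoˡ-< (size (∁ X)) (≰⇒> large) ⟩
      size X + size (∁ X) ≡⟨ size-∁ X ⟩
      2 ^ n               ≤⟨ ≤ᵇ⇒≤ _ _ t₂ ⟩
      m + m               ∎)))
    where open ≤-Reasoning

-- Codes: bit i of a number below 2ⁿ is coordinate i of a vector; the bits of a
-- set follow the lexicographic order of vectors; an affine map is given by its
-- value at 𝟎 and its columns, as digits in base 2ⁿ.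

infixl 7 _%2^_

_%2^_ : ℕ → ℕ → ℕ
m %2^ n = _%_ m (2 ^ n) {{m^n≢0 2 n}}

vector : ∀ n → ℕ → 𝔽₂^ n
vector zero    c = []
vector (suc n) c = (c % 2 ≡ᵇ 1) ∷ vector n (c / 2)

subset : ∀ n → ℕ → Subset n
subset zero    c = leaf (c ≡ᵇ 1)
subset (suc n) c = node (subset n (c %2^ (2 ^ n))) (subset n (c /2^ (2 ^ n)))

columns : ∀ n k → ℕ → Vec (𝔽₂^ n) k
columns n zero    c = []
columns n (suc k) c = vector n c ∷ columns n k (c /2^ n)

affine : ∀ n → ℕ → Affine n
affine n c = vector n c , columns n n (c /2^ n)

Code : Set
Code = ℕ × List ℕ × List (ℕ × ℕ)

decode : ∀ n → Code → Representative n
decode n (R , gs , es) =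
  representative (subset n R) (map (affine n) gs) (map (λ (x , f) → vector n x , affine n f) es)

-- Progressions in (ℤ/4)ⁿ

digit : Bool → Bool → Fin 4
digit false false = 0F
digit true  false = 1F
digit false true  = 2F
digit true  true  = 3F

low high : Fin 4 → Bool
low  a = toℕ a % 2 ≡ᵇ 1
high a = toℕ a / 2 ≡ᵇ 1

lows highs : ℤ/ 4 ^ n → 𝔽₂^ n
lows  = Vec.map low
highs = Vec.map high

split : ℤ/ 4 ^ n → 𝔽₂^ n × 𝔽₂^ n
split x = lows x , highs x

join : 𝔽₂^ n × 𝔽₂^ n → ℤ/ 4 ^ n
join (u , b) = zipWith digit u b

split-join : (p : 𝔽₂^ n × 𝔽₂^ n) → split (join p) ≡ p
split-join ([]    , [])    = refl
split-join (a ∷ u , c ∷ b) with digits a c | split-join (u , b)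
  where
  digits : ∀ a c → (low (digit a c) , high (digit a c)) ≡ (a , c)
  digits false false = refl
  digits false true  = refl
  digits true  false = refl
  digits true  true  = refl
... | eq | eqs = cong₂ _,_ (cong₂ _∷_ (cong proj₁ eq) (cong proj₁ eqs)) (cong₂ _∷_ (cong proj₂ eq) (cong proj₂ eqs))

join-split : (x : ℤ/ 4 ^ n) → join (split x) ≡ x
join-split []      = refl
join-split (a ∷ x) = cong₂ _∷_ (from-yes (Fin.all? λ a → digit (low a) (high a) Fin.≟ a) a) (join-split x)

infixl 6 _+₄_

_+₄_ : Fin 4 → Fin 4 → Fin 4
a +₄ b = (toℕ a + toℕ b) mod 4

low-end : ∀ a e → low (a +₄ e +₄ e) ≡ low a
low-end = from-yes (Fin.all? λ a → Fin.all? λ e → low (a +₄ e +₄ e) ≟ᵇ low a)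

-- Adding `2e` changes the high bit by the parity of `e`, so that parity can be read off the two
-- ends.
low-middle : ∀ a e → low (a +₄ e) ≡ low a xor (high a xor high (a +₄ e +₄ e))
low-middle = from-yes (Fin.all? λ a → Fin.all? λ e → low (a +₄ e) ≟ᵇ low a xor (high a xor high (a +₄ e +₄ e)))

lows-end : (x d : ℤ/ 4 ^ n) → lows (x ⊕ d ⊕ d) ≡ lows x
lows-end []      []      = refl
lows-end (a ∷ x) (e ∷ d) = cong₂ _∷_ (low-end a e) (lows-end x d)

lows-middle : (x d : ℤ/ 4 ^ n) → lows (x ⊕ d) ≡ lows x ⊞ (highs x ⊞ highs (x ⊕ d ⊕ d))
lows-middle []      []      = refl
lows-middle (a ∷ x) (e ∷ d) = cong₂ _∷_ (low-middle a e) (lows-middle x d)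

-- The difference `b - a`, with 3 standing for -1.
gap : Fin 4 → Fin 4 → Fin 4
gap a b = (toℕ b + 3 * toℕ a) mod 4

-- `2(b - a)` depends only on the parity of `b - a`, which the hypotheses make `high a xor high c`.
-- Doubling the gap thus flips the high bit exactly when the ends differ, so both lifts of the
-- prescribed parity are midpoints.
gap-step : ∀ a b c → low c ≡ low a → low b ≡ low a xor (high a xor high c) →
  a +₄ gap a b ≡ b × b +₄ gap a b ≡ c
gap-step = from-yes (Fin.all? λ a → Fin.all? λ b → Fin.all? λ c →
  (low c ≟ᵇ low a) →-dec ((low b ≟ᵇ low a xor (high a xor high c)) →-dec
  (a +₄ gap a b Fin.≟ b ×-dec b +₄ gap a b Fin.≟ c)))

gap-steps : (x y z : ℤ/ 4 ^ n) → lows z ≡ lows x → lows y ≡ lows x ⊞ (highs x ⊞ highs z) →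
  x ⊕ zipWith gap x y ≡ y × y ⊕ zipWith gap x y ≡ z
gap-steps []      []      []      _  _  = refl , refl
gap-steps (a ∷ x) (b ∷ y) (c ∷ z) eq eq′
  with eq₀ , eqs ← ∷-injective eq | eq₀′ , eqs′ ← ∷-injective eq′
  with step₁ , step₂ ← gap-step a b c eq₀ eq₀′ | steps₁ , steps₂ ← gap-steps x y z eqs eqs′
  = cong₂ _∷_ step₁ steps₁ , cong₂ _∷_ step₂ steps₂

split-injective : {x y : ℤ/ 4 ^ n} → split x ≡ split y → x ≡ y
split-injective {x = x} {y} eq = trans (sym (join-split x)) (trans (cong join eq) (join-split y))

join-injective : {p q : 𝔽₂^ n × 𝔽₂^ n} → join p ≡ join q → p ≡ q
join-injective {p = p} {q} eq = trans (sym (split-join p)) (trans (cong split eq) (split-join q))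

free⇒configuration : {S : List (ℤ/ 4 ^ n)} → Unique S → ProgressionFree 3 S →
  Configuration (fromList (map lows S)) (map split S)
free⇒configuration S! free .Configuration.unique = Unique.map⁺ split-injective S!
free⇒configuration {S = S} S! free .Configuration.supported p∈ with x , x∈S , refl ← ∈-map⁻ split p∈ =
  fromList-∈ (map lows S) (∈-map⁺ lows x∈S)
free⇒configuration {n} {S} S! free .Configuration.separated p∈ q∈ b≢c t
  with ∈-map⁻ split p∈ | ∈-map⁻ split q∈ | ∈-map⁻ lows (∈-fromList (map lows S) t)
... | x , x∈S , refl | z , z∈S , split-z | y , y∈S , y-low = free x (zipWith gap x y)
  (subst Unique (sym terms) ((x≢y ∷ x≢z ∷ []) ∷ (y≢z ∷ []) ∷ [] ∷ []))
  (subst (_⊆ S) (sym terms) λ { (here refl) → x∈S ; (there (here refl)) → y∈S ; (there (there (here refl))) → z∈S })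
  where
  z-low : lows z ≡ lows x
  z-low = sym (cong proj₁ split-z)
  x≢z : x ≢ z
  x≢z refl = b≢c (sym (cong proj₂ split-z))
  steps : x ⊕ zipWith gap x y ≡ y × y ⊕ zipWith gap x y ≡ z
  steps = gap-steps x y z z-low (trans (sym y-low) (cong (λ c → lows x ⊞ (highs x ⊞ c)) (cong proj₂ split-z)))
  terms : progression 3 x (zipWith gap x y) ≡ x ∷ y ∷ z ∷ []
  terms = trans (cong (λ y′ → x ∷ y′ ∷ y′ ⊕ zipWith gap x y ∷ []) (proj₁ steps))
                (cong (λ z′ → x ∷ y ∷ z′ ∷ []) (proj₂ steps))
  -- The middle lies over `u + b + c` with `b ≠ c`, hence in a different class modulo 2 from the
  -- ends; this makes the progression proper.
  low-x≢low-y : lows x ≢ lows y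
  low-x≢low-y eq = b≢c (⊞≡𝟎 (trans (⊞-move (trans y-low (sym eq))) (⊞-self (lows x))))
  x≢y : x ≢ y
  x≢y = low-x≢low-y ∘ cong lows
  y≢z : y ≢ z
  y≢z eq = low-x≢low-y (trans (sym z-low) (cong lows (sym eq)))

module _ {S : List (𝔽₂^ n × 𝔽₂^ n)} (conf : Configuration (fromList (map proj₁ S)) S) where

  open Configuration conf

  join-∈ : ∀ {x} → x ∈ map join S → split x ∈ S
  join-∈ x∈ with p , p∈S , refl ← ∈-map⁻ join x∈ = subst (_∈ S) (sym (split-join p)) p∈S

  configuration⇒free : ProgressionFree 3 (map join S)
  configuration⇒free x d ((_ ∷ x≢z ∷ []) ∷ _) ⊆S = separated
    (join-∈ (⊆S (here refl)))
    (subst (λ u → (u , highs z) ∈ S) (lows-end x d) (join-∈ (⊆S (there (there (here refl))))))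
    -- The ends agree modulo 2, so being distinct they differ in their high bits.
    (λ eq → x≢z (split-injective (cong₂ _,_ (sym (lows-end x d)) eq)))
    (subst (λ v → T (fromList (map proj₁ S) ⟨ v ⟩)) (lows-middle x d)
      (fromList-∈ (map proj₁ S) (∈-map⁺ proj₁ (join-∈ (⊆S (there (here refl)))))))
    where
    z : ℤ/ 4 ^ n
    z = x ⊕ d ⊕ d

-- Upper and lower bounds

upper : ∀ {N} (ls : List (Level n)) → T (certifies N ls) →
  (S : List (ℤ/ 4 ^ n)) → Unique S → ProgressionFree 3 S → length S ≤ N
upper {N = N} ls t S S! free = subst (_≤ N) (length-map split S)
  (certifies-sound ls t (fromList (map lows S)) (map split S) (free⇒configuration S! free))

-- Explicit sets attaining the values.

separatedᵇ : Subset n → List (𝔽₂^ n × 𝔽₂^ n) → Bool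
separatedᵇ X S =
  all (λ (u , b) → all (λ (v , c) → nonzero (u ⊞ v) ∨ not (nonzero (b ⊞ c)) ∨ not (X ⟨ u ⊞ (b ⊞ c) ⟩)) S) S

isConfiguration : List (𝔽₂^ n × 𝔽₂^ n) → Bool
isConfiguration S = isYes (unique? S) ∧ separatedᵇ (fromList (map proj₁ S)) S
  where open import Data.List.Relation.Unary.Unique.DecPropositional (×-≡-dec _≟_ _≟_) using (unique?)

isConfiguration-sound : (S : List (𝔽₂^ n × 𝔽₂^ n)) → T (isConfiguration S) → Configuration (fromList (map proj₁ S)) S
isConfiguration-sound {n} S t = record
  { unique    = toWitness (proj₁ ts)
  ; supported = λ p∈ → fromList-∈ (map proj₁ S) (∈-map⁺ proj₁ p∈)
  ; separated = λ {u} {b} {c} p∈ q∈ → sep u b c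
      (All.lookup (All.all⁺ _ S (All.lookup (All.all⁺ _ S (proj₂ ts)) p∈)) q∈)
  }
  where
  open import Data.List.Relation.Unary.Unique.DecPropositional (×-≡-dec (_≟_ {n}) (_≟_ {n})) using (unique?)
  X : Subset n
  X = fromList (map proj₁ S)
  ts : T (isYes (unique? S)) × T (separatedᵇ X S)
  ts = to (T-∧ {isYes (unique? S)}) t
  sep : ∀ u b c → T (nonzero (u ⊞ u) ∨ not (nonzero (b ⊞ c)) ∨ not (X ⟨ u ⊞ (b ⊞ c) ⟩)) →
    b ≢ c → ¬ T (X ⟨ u ⊞ (b ⊞ c) ⟩)
  sep u b c t b≢c v∈X with to (T-∨ {nonzero (u ⊞ u)}) t
  ... | inj₁ t₁ = nonzero⇒≢ {u = u} t₁ refl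
  ... | inj₂ t′ with nonzero (b ⊞ c) | ≢⇒nonzero b≢c | X ⟨ u ⊞ (b ⊞ c) ⟩
  ...   | true | _ | true = t′

weight : 𝔽₂^ n → ℕ
weight []          = 0
weight (false ∷ v) = weight v
weight (true ∷ v)  = suc (weight v)

infix 4 _≤ᵛ_

_≤ᵛ_ : 𝔽₂^ n → 𝔽₂^ n → Bool
[]          ≤ᵛ []      = true
(false ∷ u) ≤ᵛ (b ∷ v) = u ≤ᵛ v
(true ∷ u)  ≤ᵛ (b ∷ v) = b ∧ (u ≤ᵛ v)

-- The greedy lexicographic code on the support of `u`, with minimum distance greater than `r`.
lexicode : ℕ → 𝔽₂^ n → List (𝔽₂^ n)
lexicode {n} r u = keep [] (elements (constant true))
  where
  keep : List (𝔽₂^ n) → List (𝔽₂^ n) → List (𝔽₂^ n)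
  keep C []       = C
  keep C (b ∷ bs) = if (b ≤ᵛ u) ∧ all (λ c → r <ᵇ weight (b ⊞ c)) C then keep (b ∷ C) bs else keep C bs

-- If b, c ≤ u have distance greater than weight u ∸ t then u + b + c has weight
-- less than t.
heavy : ∀ n → ℕ → List (𝔽₂^ n × 𝔽₂^ n)
heavy n t = concatMap over (elements (constant true))
  where
  over : 𝔽₂^ n → List (𝔽₂^ n × 𝔽₂^ n)
  over u = if t ≤ᵇ weight u then map (u ,_) (lexicode (weight u ∸ t) u) else []

exactly : ∀ n t {N} (levels : List (List Code)) → T (isConfiguration (heavy n t)) → length (heavy n t) ≡ N →
  T (certifies N (map (map (decode n)) levels)) → r 3 ⟨ℤ/ 4 ^ n ⟩≐ N
exactly n t levels ok refl certified =
  (map join (heavy n t) , Unique.map⁺ join-injective (Configuration.unique conf) ,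
    configuration⇒free conf , length-map join (heavy n t)) ,
  upper (map (map (decode n)) levels) certified
  where
  conf : Configuration (fromList (map proj₁ (heavy n t))) (heavy n t)
  conf = isConfiguration-sound (heavy n t) ok

-- Level j holds the affine classes of subsets with j elements.

levels1 : List (List Code)
levels1 =
  ((0 , 3 ∷ [] , (0 , 2) ∷ []) ∷ [])
  ∷ ((1 , [] , []) ∷ [])
  ∷ []

levels2 : List (List Code)
levels2 =
  ((0 , 47 ∷ [] , (0 , 36) ∷ []) ∷ [])
  ∷ ((1 , 24 ∷ 52 ∷ [] , (2 , 36) ∷ []) ∷ [])
  ∷ ((3 , 46 ∷ [] , []) ∷ [])
  ∷ []

levels3 : List (List Code)
levels3 =
  ((0 , 3428 ∷ 2550 ∷ [] , (0 , 2184) ∷ []) ∷ [])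
  ∷ ((1 , 3208 ∷ 784 ∷ [] , (4 , 2184) ∷ []) ∷ [])
  ∷ ((3 , 2440 ∷ 2128 ∷ 2248 ∷ [] , (2 , 2184) ∷ []) ∷ [])
  ∷ ((7 , 2216 ∷ 2200 ∷ [] , (6 , 2184) ∷ (1 , 2184) ∷ []) ∷ [])
  ∷ ((15 , 2494 ∷ [] , []) ∷ (23 , 3428 ∷ [] , []) ∷ [])
  ∷ []

levels4 : List (List Code)
levels4 =
  ((0 , 829832 ∷ 585164 ∷ [] , (0 , 541200) ∷ []) ∷ [])
  ∷ ((1 , 803344 ∷ 99360 ∷ [] , (8 , 541200) ∷ []) ∷ [])
  ∷ ((3 , 573968 ∷ 549392 ∷ 529440 ∷ [] , (4 , 541200) ∷ []) ∷ [])
  ∷ ((7 , 543248 ∷ 542224 ∷ 540960 ∷ 541456 ∷ [] , (12 , 541200) ∷ (2 , 541200) ∷ []) ∷ [])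
  ∷ ((15 , 543248 ∷ 542224 ∷ 540960 ∷ 541456 ∷ [] , (2 , 541200) ∷ []) ∷ (23 , 272400 ∷ 680498 ∷ 541328 ∷ []
     , (12 , 541200) ∷ (1 , 541200) ∷ []) ∷ [])
  ∷ ((31 , 295440 ∷ 803344 ∷ 541328 ∷ 541232 ∷ [] , (10 , 541200) ∷ (1 , 541200) ∷ []) ∷ (279 , 272400 ∷
     680738 ∷ [] , (12 , 541200) ∷ (15 , 541200) ∷ []) ∷ [])
  ∷ ((63 , 573968 ∷ 541264 ∷ 541232 ∷ [] , (6 , 541200) ∷ (1 , 541200) ∷ []) ∷ (287 , 803344 ∷ 540960 ∷
     821912 ∷ [] , (10 , 541200) ∷ (3 , 541200) ∷ []) ∷ (33047 , 272400 ∷ 988192 ∷ [] , (12 , 973004) ∷ []) ∷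
     [])
  ∷ ((127 , 541328 ∷ 541264 ∷ 541232 ∷ [] , (14 , 541200) ∷ (1 , 541200) ∷ []) ∷ (319 , 573968 ∷ 533520 ∷
     549426 ∷ [] , (6 , 541200) ∷ (9 , 541200) ∷ (5 , 541200) ∷ []) ∷ (4383 , 295440 ∷ 803344 ∷ 540960 ∷
     541456 ∷ [] , (10 , 533520) ∷ []) ∷ [])
  ∷ ((255 , 829592 ∷ 584924 ∷ [] , []) ∷ (383 , 305304 ∷ [] , []) ∷ (831 , 576152 ∷ 550212 ∷ [] , []) ∷ (1343
     , 297384 ∷ 543248 ∷ [] , []) ∷ [])
  ∷ []

levels5 : List (List Code)
levels5 =
  ((0 , 826885648 ∷ 567109400 ∷ [] , (0 , 545392672) ∷ []) ∷ [])
  ∷ ((1 , 813828128 ∷ 50597952 ∷ [] , (16 , 545392672) ∷ []) ∷ [])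
  ∷ ((3 , 562169888 ∷ 549586976 ∷ 538185792 ∷ [] , (8 , 545392672) ∷ []) ∷ [])
  ∷ ((7 , 545916960 ∷ 545654816 ∷ 545458208 ∷ 545296448 ∷ [] , (24 , 545392672) ∷ (4 , 545392672) ∷ []) ∷ [])
  ∷ ((15 , 545916960 ∷ 545654816 ∷ 545458208 ∷ 545296448 ∷ [] , (4 , 545392672) ∷ []) ∷ (23 , 273156128 ∷
     683808932 ∷ 545391680 ∷ 545393696 ∷ [] , (24 , 545392672) ∷ (2 , 545392672) ∷ []) ∷ [])
  ∷ ((31 , 285345824 ∷ 813828128 ∷ 545409056 ∷ 545396768 ∷ 545391680 ∷ 545393696 ∷ [] , (20 , 545392672) ∷ (2
     , 545392672) ∷ []) ∷ (279 , 273156128 ∷ 683872420 ∷ 545393184 ∷ [] , (24 , 545392672) ∷ (30 , 545392672)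
     ∷ (1 , 545392672) ∷ []) ∷ [])
  ∷ ((63 , 562169888 ∷ 545400864 ∷ 545396768 ∷ 545391680 ∷ 545393696 ∷ [] , (12 , 545392672) ∷ (2 ,
     545392672) ∷ []) ∷ (287 , 813828128 ∷ 545329184 ∷ 822757936 ∷ 545392800 ∷ [] , (20 , 545392672) ∷ (6 ,
     545392672) ∷ (1 , 545392672) ∷ []) ∷ (33047 , 273156128 ∷ 1008996384 ∷ 545393184 ∷ [] , (24 , 967336760)
     ∷ (1 , 545392672) ∷ []) ∷ (65815 , 273156128 ∷ 683873412 ∷ [] , (24 , 545392672) ∷ (30 , 545392672) ∷
     []) ∷ [])
  ∷ ((127 , 545409056 ∷ 545400864 ∷ 545396768 ∷ 545391680 ∷ 545393696 ∷ [] , (28 , 545392672) ∷ (2 ,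
     545392672) ∷ []) ∷ (319 , 562169888 ∷ 541329440 ∷ 549591204 ∷ 545392736 ∷ [] , (12 , 545392672) ∷ (18 ,
     545392672) ∷ (10 , 545392672) ∷ (1 , 545392672) ∷ []) ∷ (4383 , 285345824 ∷ 813828128 ∷ 545329184 ∷
     545458208 ∷ 545393184 ∷ 545392800 ∷ [] , (20 , 541329440) ∷ (1 , 545392672) ∷ []) ∷ (65823 , 813828128 ∷
     822757936 ∷ 545296448 ∷ [] , (20 , 545392672) ∷ (6 , 545392672) ∷ (7 , 545392672) ∷ (23 , 545392672) ∷
     []) ∷ (98583 , 273156128 ∷ 1008996384 ∷ 818225448 ∷ [] , (24 , 967336760) ∷ (17 , 538185792) ∷ []) ∷ [])
  ∷ ((255 , 545409056 ∷ 545400864 ∷ 545396768 ∷ 545391680 ∷ 545393696 ∷ [] , (2 , 545392672) ∷ []) ∷ (383 ,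
     285345824 ∷ 948312228 ∷ 545392736 ∷ [] , (28 , 545392672) ∷ (18 , 545392672) ∷ (1 , 545392672) ∷ []) ∷
     (831 , 562169888 ∷ 541138976 ∷ 547555426 ∷ 545392928 ∷ [] , (12 , 545392672) ∷ (1 , 545392672) ∷ []) ∷
     (1343 , 545916960 ∷ 285282336 ∷ 545392800 ∷ [] , (12 , 285345824) ∷ (6 , 545392672) ∷ (1 , 545392672) ∷
     []) ∷ (65855 , 562169888 ∷ 541329440 ∷ 549591204 ∷ 545391680 ∷ [] , (12 , 545392672) ∷ (18 , 545392672)
     ∷ (10 , 545392672) ∷ (3 , 545392672) ∷ (15 , 545392672) ∷ []) ∷ (69919 , 545329184 ∷ 545458208 ∷
     136847392 ∷ [] , (20 , 541329440) ∷ (17 , 545296448) ∷ (21 , 545392672) ∷ []) ∷ (268501279 , 813828128 ∷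
     204522785 ∷ [] , (20 , 549591204) ∷ []) ∷ (536936735 , 562169888 ∷ 545329184 ∷ 546014272 ∷ 545663272 ∷
     545391680 ∷ [] , (20 , 566909620) ∷ (12 , 285345824) ∷ (6 , 545458208) ∷ []) ∷ [])
  ∷ ((511 , 813828128 ∷ 151259168 ∷ 545393184 ∷ 545392736 ∷ [] , (18 , 545392672) ∷ (1 , 545392672) ∷ []) ∷
     (895 , 562694176 ∷ 541329440 ∷ 549591204 ∷ 545392736 ∷ [] , (28 , 545392672) ∷ (10 , 545392672) ∷ (1 ,
     545392672) ∷ []) ∷ (65919 , 285345824 ∷ 948312228 ∷ 545391680 ∷ [] , (28 , 545392672) ∷ (18 , 545392672)
     ∷ (3 , 545392672) ∷ (31 , 545392672) ∷ []) ∷ (66367 , 562169888 ∷ 541138976 ∷ 547555426 ∷ [] , (12 ,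
     545392672) ∷ (17 , 545392672) ∷ (9 , 545392672) ∷ (15 , 545392672) ∷ []) ∷ (5439 , 612516400 ∷ 285282336
     ∷ 545393184 ∷ [] , (12 , 273156128) ∷ (30 , 545392672) ∷ (1 , 545392672) ∷ []) ∷ (66879 , 545916960 ∷
     285282336 ∷ 545663272 ∷ [] , (12 , 285345824) ∷ (6 , 545392672) ∷ (17 , 545391680) ∷ (25 , 545392672) ∷
     (5 , 545392672) ∷ (7 , 545392672) ∷ []) ∷ (16843071 , 562169888 ∷ 541329440 ∷ 545391680 ∷ 545393696 ∷ []
     , (12 , 545392672) ∷ (18 , 539234336) ∷ (10 , 285282336) ∷ (14 , 549591204) ∷ []) ∷ (1073807679 ,
     562694176 ∷ 541329440 ∷ 545391680 ∷ 549596324 ∷ [] , (12 , 679885228) ∷ (28 , 822216736) ∷ (18 ,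
     545392672) ∷ (10 , 545400864) ∷ []) ∷ (2167071 , 136847392 ∷ 689052036 ∷ [] , (20 , 541329440) ∷ (12 ,
     273291428) ∷ (10 , 271061024) ∷ (11 , 545392672) ∷ []) ∷ [])
  ∷ ((1023 , 562169888 ∷ 541329440 ∷ 549586976 ∷ 545392928 ∷ 545392736 ∷ [] , (10 , 545392672) ∷ (1 ,
     545392672) ∷ []) ∷ (66047 , 813828128 ∷ 151259168 ∷ 545391680 ∷ 826821168 ∷ [] , (18 , 545392672) ∷ (3 ,
     545392672) ∷ []) ∷ (1919 , 545329184 ∷ 562441016 ∷ 545392800 ∷ [] , (28 , 545392672) ∷ (6 , 545392672) ∷
     (1 , 545392672) ∷ []) ∷ (66431 , 562694176 ∷ 541329440 ∷ 549591204 ∷ 545409056 ∷ [] , (28 , 545392672) ∷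
     (10 , 545392672) ∷ (17 , 545392672) ∷ (9 , 545392672) ∷ (3 , 545392672) ∷ (15 , 545392672) ∷ []) ∷
     (16843135 , 285345824 ∷ 818153504 ∷ 545391680 ∷ 545393696 ∷ [] , (28 , 545392672) ∷ (18 , 545392672) ∷
     (30 , 948312228) ∷ []) ∷ (2147549567 , 285345824 ∷ 545391680 ∷ 948333732 ∷ [] , (28 , 697203644) ∷ (18 ,
     545409056) ∷ []) ∷ (197439 , 562169888 ∷ 541138976 ∷ 547556418 ∷ [] , (12 , 545392672) ∷ (15 ,
     545392672) ∷ []) ∷ (328511 , 545916960 ∷ 545329184 ∷ 545663272 ∷ 545392928 ∷ [] , (12 , 545392672) ∷ (6
     , 541138976) ∷ (17 , 545296448) ∷ (5 , 545392672) ∷ (7 , 545392672) ∷ []) ∷ (1073808191 , 562186272 ∷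
     541138976 ∷ 547555426 ∷ 545393120 ∷ [] , (12 , 545392672) ∷ (17 , 545392672) ∷ (9 , 543492450) ∷ []) ∷
     (38207 , 367073312 ∷ 545393184 ∷ [] , (12 , 677654956) ∷ (1 , 545392672) ∷ []) ∷ (70975 , 612516400 ∷
     285282336 ∷ [] , (12 , 273156128) ∷ (30 , 545392672) ∷ (17 , 545391680) ∷ (25 , 545392672) ∷ []) ∷
     (591167 , 285282336 ∷ 814516352 ∷ [] , (12 , 814089280) ∷ (6 , 545392672) ∷ (7 , 545392672) ∷ []) ∷
     (1115455 , 545409584 ∷ 545400864 ∷ 541328448 ∷ [] , (12 , 273156128) ∷ (18 , 545329184) ∷ (6 ,
     151061760) ∷ (22 , 558106656) ∷ (3 , 545392672) ∷ []) ∷ (268502335 , 285282336 ∷ 545933872 ∷ 545392864 ∷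
     [] , (12 , 289544356) ∷ (28 , 289933344) ∷ (6 , 136847392) ∷ (17 , 545391680) ∷ (25 , 545392672) ∷ (5 ,
     541332544) ∷ []) ∷ (69275935 , 285282336 ∷ 689048452 ∷ 575966241 ∷ [] , (20 , 541329440) ∷ (12 ,
     273295788) ∷ []) ∷ [])
  ∷ ((2047 , 545916960 ∷ 545654816 ∷ 545392800 ∷ 545392736 ∷ [] , (26 , 545392672) ∷ (6 , 545392672) ∷ (1 ,
     545392672) ∷ []) ∷ (66559 , 549586976 ∷ 562711088 ∷ 549726504 ∷ [] , (10 , 545392672) ∷ (17 , 545392672)
     ∷ (9 , 545392672) ∷ (3 , 545392672) ∷ []) ∷ (16843263 , 813828128 ∷ 151259168 ∷ 545391680 ∷ 545393696 ∷
     [] , (18 , 545392672) ∷ []) ∷ (6015 , 272711712 ∷ 614664224 ∷ 545393184 ∷ [] , (28 , 545392672) ∷ (1 ,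
     545392672) ∷ []) ∷ (67455 , 545329184 ∷ 822217264 ∷ 562441016 ∷ [] , (28 , 545392672) ∷ (6 , 545392672)
     ∷ (17 , 545392672) ∷ (5 , 545392672) ∷ (7 , 545392672) ∷ (23 , 545392672) ∷ []) ∷ (197503 , 541329440 ∷
     549591204 ∷ 545391680 ∷ 545409056 ∷ [] , (28 , 545392672) ∷ (10 , 545392672) ∷ (3 , 545392672) ∷ (15 ,
     545392672) ∷ []) ∷ (328575 , 545409056 ∷ 545663272 ∷ 285344832 ∷ [] , (28 , 545392672) ∷ (10 ,
     285345824) ∷ (6 , 541329440) ∷ (3 , 545392672) ∷ (7 , 545392672) ∷ []) ∷ (16843647 , 541329440 ∷
     545917488 ∷ 545392736 ∷ [] , (28 , 545392672) ∷ (10 , 545329184) ∷ (14 , 549654692) ∷ (30 , 550178980) ∷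
     (17 , 545392672) ∷ (9 , 545392672) ∷ (13 , 549591204) ∷ []) ∷ (1073808255 , 562694176 ∷ 541329440 ∷
     549591396 ∷ [] , (28 , 545667500) ∷ (10 , 285345824) ∷ (17 , 545392672) ∷ (9 , 285353024) ∷ []) ∷
     (1073939263 , 562186272 ∷ 541138976 ∷ 547556418 ∷ [] , (12 , 545392672) ∷ (31 , 545392672) ∷ []) ∷
     (1377087 , 545409584 ∷ 545409056 ∷ 541329440 ∷ 549591076 ∷ [] , (12 , 273155136) ∷ (10 , 545329184) ∷
     (17 , 538185792) ∷ (13 , 273187937) ∷ (29 , 545392672) ∷ (3 , 545392672) ∷ (11 , 545392672) ∷ []) ∷
     (268763967 , 545933344 ∷ 543238242 ∷ [] , (12 , 545392672) ∷ (17 , 546346081) ∷ (25 , 546574400) ∷ (5 ,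
     541139104) ∷ (15 , 545392672) ∷ (31 , 545392672) ∷ []) ∷ (103743 , 367073312 ∷ 151068704 ∷ 419500196 ∷
     [] , (12 , 677654956) ∷ (17 , 545391680) ∷ []) ∷ (595263 , 285282336 ∷ 545655336 ∷ [] , (12 , 411838496)
     ∷ (22 , 539365540) ∷ (30 , 813892672) ∷ (17 , 545820736) ∷ (5 , 151061760) ∷ (7 , 545392672) ∷ []) ∷
     (269026623 , 285282336 ∷ 546179624 ∷ 814525056 ∷ [] , (12 , 294004768) ∷ (6 , 545392672) ∷ (23 ,
     562270240) ∷ []) ∷ (17892671 , 37830912 ∷ [] , (12 , 273156128) ∷ (28 , 273173040) ∷ (22 , 88121472) ∷
     (30 , 688201760) ∷ (31 , 545392672) ∷ []) ∷ [])
  ∷ ((4095 , 545916960 ∷ 545654816 ∷ 545392800 ∷ 545392736 ∷ [] , (6 , 545392672) ∷ (1 , 545392672) ∷ []) ∷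
     (6143 , 273156128 ∷ 683808800 ∷ 545392736 ∷ [] , (26 , 545392672) ∷ (1 , 545392672) ∷ []) ∷ (67583 ,
     285345824 ∷ 813836320 ∷ 546204472 ∷ 545396900 ∷ [] , (26 , 545392672) ∷ (6 , 545392672) ∷ (17 ,
     545392672) ∷ (5 , 545392672) ∷ (3 , 545392672) ∷ []) ∷ (197631 , 549586976 ∷ 545391680 ∷ 562711088 ∷
     549726504 ∷ [] , (10 , 545392672) ∷ (3 , 545392672) ∷ []) ∷ (328703 , 545409056 ∷ 545654816 ∷ 285344832
     ∷ 545396900 ∷ [] , (10 , 285345824) ∷ (6 , 541329440) ∷ (3 , 545392672) ∷ []) ∷ (16843775 , 562169888 ∷
     541329440 ∷ 549586976 ∷ 545392736 ∷ [] , (10 , 545392672) ∷ (17 , 545392672) ∷ (9 , 545392672) ∷ []) ∷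
     (71551 , 272711712 ∷ 614664224 ∷ [] , (28 , 545392672) ∷ (17 , 545392672) ∷ (29 , 545392672) ∷ []) ∷
     (198527 , 545329184 ∷ 545663272 ∷ 562710560 ∷ 545393184 ∷ [] , (28 , 545392672) ∷ (6 , 545392672) ∷ (9 ,
     545392672) ∷ (5 , 545392672) ∷ (7 , 545392672) ∷ (15 , 545392672) ∷ []) ∷ (1116031 , 822217264 ∷
     545392800 ∷ [] , (28 , 545392672) ∷ (26 , 545329184) ∷ (6 , 151259168) ∷ (30 , 956590904) ∷ (17 ,
     545392672) ∷ (3 , 545392672) ∷ (19 , 545392672) ∷ []) ∷ (268502911 , 545329184 ∷ 285887024 ∷ 814098464 ∷
     545392864 ∷ [] , (28 , 545396900) ∷ (6 , 220530720) ∷ (17 , 545392672) ∷ (5 , 545329312) ∷ []) ∷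
     (536938367 , 545329184 ∷ 545663272 ∷ 562710560 ∷ 545393376 ∷ [] , (28 , 822237348) ∷ (6 , 541138976) ∷
     (17 , 545393184) ∷ (9 , 285345824) ∷ (5 , 545392800) ∷ []) ∷ (16974719 , 545391680 ∷ 539009152 ∷
     545917488 ∷ [] , (28 , 545392672) ∷ (10 , 545329184) ∷ (14 , 549654692) ∷ (15 , 545392672) ∷ []) ∷
     (1073939327 , 562694176 ∷ 541329440 ∷ 549591204 ∷ 545391680 ∷ [] , (28 , 545667500) ∷ (10 , 545392672) ∷
     (3 , 545392672) ∷ (31 , 545392672) ∷ []) ∷ (17105791 , 545663016 ∷ 285344832 ∷ [] , (28 , 545392672) ∷
     (10 , 285282336) ∷ (6 , 541329440) ∷ (22 , 557932576) ∷ (19 , 538249410) ∷ (27 , 545392672) ∷ (7 ,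
     545392672) ∷ []) ∷ (268764031 , 545663272 ∷ 285344832 ∷ [] , (28 , 545396900) ∷ (10 , 285345824) ∷ (26 ,
     285806624) ∷ (6 , 155398176) ∷ (3 , 545392672) ∷ (23 , 540225668) ∷ (31 , 545392672) ∷ []) ∷ (3221422911
     , 562169888 ∷ 541138976 ∷ 552636480 ∷ [] , (12 , 545392672) ∷ []) ∷ (9765695 , 562170016 ∷ 541329440 ∷
     549591076 ∷ [] , (12 , 948057548) ∷ (10 , 545329184) ∷ (17 , 546489969) ∷ (3 , 545392672) ∷ []) ∷
     (18154303 , 578947600 ∷ 541138976 ∷ 547555362 ∷ [] , (12 , 273155136) ∷ (17 , 538185792) ∷ (29 ,
     545392672) ∷ []) ∷ (68485951 , 545393200 ∷ 545329440 ∷ 545663016 ∷ [] , (12 , 281337920) ∷ (6 ,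
     541138976) ∷ (17 , 546344097) ∷ (21 , 538316996) ∷ (13 , 411870529) ∷ (29 , 558106912) ∷ (7 , 545392672)
     ∷ (23 , 545392672) ∷ []) ∷ (1342505791 , 545933344 ∷ 274777185 ∷ [] , (12 , 271765636) ∷ (5 , 541139104)
     ∷ []) ∷ (2416247615 , 543238242 ∷ 560269666 ∷ [] , (12 , 545392672) ∷ (17 , 542746161) ∷ (5 , 539123872)
     ∷ []) ∷ (269030719 , 616841272 ∷ 285282336 ∷ [] , (12 , 407064608) ∷ (30 , 811638848) ∷ (17 , 270027472)
     ∷ (13 , 410089670) ∷ (31 , 811639905) ∷ []) ∷ (2165376319 , 541983972 ∷ 285282336 ∷ [] , (12 ,
     943996204) ∷ []) ∷ [])
  ∷ ((8191 , 285345824 ∷ 813828128 ∷ 545393184 ∷ 545392800 ∷ 545392736 ∷ [] , (22 , 545392672) ∷ (1 ,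
     545392672) ∷ []) ∷ (69631 , 545654816 ∷ 285345824 ∷ 813828128 ∷ 545329184 ∷ 545458274 ∷ [] , (6 ,
     545392672) ∷ (17 , 545392672) ∷ (5 , 545392672) ∷ []) ∷ (71679 , 273156128 ∷ 683808800 ∷ 545418040 ∷ []
     , (26 , 545392672) ∷ (17 , 545392672) ∷ (29 , 545392672) ∷ (3 , 545392672) ∷ []) ∷ (198655 , 562186272 ∷
     545663272 ∷ 545396900 ∷ [] , (26 , 545392672) ∷ (6 , 545392672) ∷ (9 , 545392672) ∷ (5 , 545392672) ∷ (3
     , 545392672) ∷ []) ∷ (1116159 , 822233120 ∷ 545392800 ∷ 545418040 ∷ [] , (26 , 545392672) ∷ (6 ,
     151259168) ∷ (30 , 956565536) ∷ (17 , 545392672) ∷ (3 , 545392672) ∷ []) ∷ (16844799 , 545654816 ∷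
     285345824 ∷ 814090536 ∷ 545392736 ∷ [] , (26 , 545329184) ∷ (6 , 545392672) ∷ (17 , 545392672) ∷ (5 ,
     545392672) ∷ []) ∷ (16974847 , 562169888 ∷ 541329440 ∷ 549586976 ∷ 545391680 ∷ [] , (10 , 545392672) ∷
     (19 , 545392672) ∷ (11 , 545392672) ∷ []) ∷ (17105919 , 545917488 ∷ 545654816 ∷ 285344832 ∷ [] , (10 ,
     285345824) ∷ (6 , 541329440) ∷ (19 , 545393728) ∷ (27 , 545392672) ∷ (7 , 545392672) ∷ []) ∷ (202623 ,
     541138976 ∷ 562710560 ∷ 545393184 ∷ [] , (28 , 545392672) ∷ (14 , 272711712) ∷ (9 , 545392672) ∷ (13 ,
     545392672) ∷ (15 , 545392672) ∷ []) ∷ (8460159 , 273156128 ∷ 683809696 ∷ [] , (28 , 545392672) ∷ (26 ,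
     621572392) ∷ (17 , 545393184) ∷ (3 , 84152352) ∷ []) ∷ (460671 , 822216752 ∷ 562440504 ∷ 545296448 ∷ []
     , (28 , 545392672) ∷ (6 , 545392672) ∷ (7 , 545392672) ∷ (31 , 545392672) ∷ []) ∷ (1247103 , 562170416 ∷
     541328448 ∷ [] , (28 , 545392672) ∷ (26 , 545329184) ∷ (6 , 541329440) ∷ (14 , 549726504) ∷ (3 ,
     545392672) ∷ (19 , 545392672) ∷ (11 , 545392672) ∷ (15 , 545392672) ∷ []) ∷ (268633983 , 545329184 ∷
     545663272 ∷ 562710560 ∷ [] , (28 , 545396900) ∷ (6 , 541138976) ∷ (9 , 545392672) ∷ (5 , 541241540) ∷
     (23 , 543270978) ∷ (15 , 545392672) ∷ []) ∷ (1073940351 , 545329184 ∷ 545663272 ∷ 562711072 ∷ [] , (28 ,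
     545667500) ∷ (6 , 545392672) ∷ (9 , 814098720) ∷ (25 , 822757408) ∷ (5 , 545392672) ∷ (7 , 545392672) ∷
     (31 , 545392672) ∷ []) ∷ (17893247 , 545329184 ∷ 822217264 ∷ [] , (28 , 545392672) ∷ (6 , 136847392) ∷
     (30 , 212429688) ∷ (17 , 545392672) ∷ (21 , 541110468) ∷ (7 , 136881185) ∷ (23 , 545392672) ∷ []) ∷
     (34670463 , 562647072 ∷ 562170416 ∷ [] , (28 , 545409584) ∷ (6 , 610347040) ∷ (14 , 159457576) ∷ (17 ,
     545392672) ∷ (9 , 285345824) ∷ (21 , 558650944) ∷ (13 , 273159232) ∷ (7 , 545392800) ∷ (23 , 153650465)
     ∷ (15 , 545392672) ∷ []) ∷ (1090716543 , 545409568 ∷ 545391680 ∷ 539009152 ∷ [] , (28 , 549586976) ∷ (10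
     , 545329184) ∷ (14 , 549654692) ∷ (31 , 540476577) ∷ []) ∷ (3221422975 , 562694176 ∷ 541329440 ∷
     551650465 ∷ [] , (28 , 551985548) ∷ (10 , 545392672) ∷ []) ∷ (151323519 , 545663016 ∷ 285344832 ∷
     814116128 ∷ [] , (28 , 545392672) ∷ (10 , 815867082) ∷ (6 , 541329440) ∷ []) ∷ (285541247 , 541329504 ∷
     285344832 ∷ [] , (28 , 545392672) ∷ (10 , 270649538) ∷ (26 , 285299248) ∷ (14 , 419631204) ∷ (30 ,
     956518564) ∷ []) ∷ (2416247679 , 545663272 ∷ 285344832 ∷ 813841448 ∷ [] , (28 , 545396900) ∷ (10 ,
     814098656) ∷ (6 , 155398176) ∷ []) ∷ (26542911 , 578947600 ∷ 541329440 ∷ 549591076 ∷ [] , (12 ,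
     575976940) ∷ (10 , 271058048) ∷ (17 , 51172977) ∷ (19 , 538253378) ∷ (27 , 545392672) ∷ []) ∷ (336921407
     , 94028336 ∷ 547631400 ∷ [] , (12 , 407032032) ∷ (17 , 546407585) ∷ (29 , 331449505) ∷ (31 , 545392672)
     ∷ []) ∷ (605356863 , 547647784 ∷ [] , (12 , 272949576) ∷ (17 , 546344097) ∷ (25 , 555005817) ∷ (13 ,
     411870529) ∷ (15 , 545329440) ∷ []) ∷ [])
  ∷ ((16383 , 562169888 ∷ 545392928 ∷ 545392800 ∷ 545392736 ∷ [] , (14 , 545392672) ∷ (1 , 545392672) ∷ []) ∷
     (73727 , 285345824 ∷ 813828128 ∷ 545933344 ∷ 545329184 ∷ 545458274 ∷ [] , (22 , 545392672) ∷ (17 ,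
     545392672) ∷ (5 , 545392672) ∷ []) ∷ (200703 , 545654816 ∷ 562169888 ∷ 545329184 ∷ 545458274 ∷ [] , (6 ,
     545392672) ∷ (9 , 545392672) ∷ (5 , 545392672) ∷ []) ∷ (1118207 , 822233120 ∷ 562194464 ∷ 545392800 ∷ []
     , (6 , 545392672) ∷ (17 , 545392672) ∷ (3 , 545392672) ∷ []) ∷ (202751 , 541329440 ∷ 562710560 ∷
     545393184 ∷ 545401128 ∷ [] , (26 , 545392672) ∷ (14 , 273156128) ∷ (9 , 545392672) ∷ (13 , 545392672) ∷
     (3 , 545392672) ∷ []) ∷ (8460287 , 273156128 ∷ 683808800 ∷ 545418040 ∷ [] , (26 , 562980896) ∷ (17 ,
     423762464) ∷ (3 , 545392672) ∷ []) ∷ (16848895 , 273156128 ∷ 683804836 ∷ 545392736 ∷ [] , (26 ,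
     545329184) ∷ (17 , 545392672) ∷ (29 , 545392672) ∷ []) ∷ (460799 , 545391680 ∷ 545933872 ∷ 545663272 ∷
     545396900 ∷ [] , (26 , 545392672) ∷ (6 , 545392672) ∷ (3 , 545392672) ∷ []) ∷ (1247231 , 545917472 ∷
     541328448 ∷ 545401128 ∷ [] , (26 , 545392672) ∷ (6 , 541329440) ∷ (14 , 549718048) ∷ (3 , 545392672) ∷
     []) ∷ (16975871 , 545654816 ∷ 562694704 ∷ [] , (26 , 545329184) ∷ (6 , 545392672) ∷ (9 , 545392672) ∷ (5
     , 545392672) ∷ (19 , 545392672) ∷ (11 , 545392672) ∷ (7 , 545392672) ∷ []) ∷ (17893375 , 822217264 ∷
     545396772 ∷ [] , (26 , 545392672) ∷ (6 , 151259168) ∷ (30 , 956565536) ∷ (17 , 545392672) ∷ (19 ,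
     545392736) ∷ (7 , 545392672) ∷ (23 , 545392672) ∷ []) ∷ (50529279 , 562169888 ∷ 541329440 ∷ 549586976 ∷
     545391680 ∷ 545393696 ∷ [] , (10 , 545392672) ∷ []) ∷ (84083711 , 545409568 ∷ 545654816 ∷ 545391680 ∷
     545663272 ∷ 545916960 ∷ [] , (10 , 545392672) ∷ (6 , 541329440) ∷ (19 , 545393696) ∷ (7 , 273157152) ∷
     []) ∷ (151323647 , 545654816 ∷ 285344832 ∷ 813853984 ∷ [] , (10 , 813836384) ∷ (6 , 541329440) ∷ []) ∷
     (285541375 , 545393200 ∷ 541329504 ∷ 285344832 ∷ [] , (10 , 285345824) ∷ (14 , 419694624) ∷ []) ∷
     (464767 , 545329184 ∷ 285345824 ∷ 814098720 ∷ [] , (28 , 545392672) ∷ (22 , 541138976) ∷ (25 ,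
     545296448) ∷ (5 , 545392672) ∷ (21 , 545392672) ∷ (7 , 545392672) ∷ (31 , 545392672) ∷ []) ∷ (4396927 ,
     407509024 ∷ [] , (28 , 545392672) ∷ (26 , 545337640) ∷ (9 , 285345824) ∷ (29 , 549621956) ∷ (3 ,
     539234336) ∷ (27 , 545392672) ∷ []) ∷ (1073944447 , 541138976 ∷ 562711072 ∷ [] , (28 , 545405356) ∷ (14
     , 272711712) ∷ (9 , 814098720) ∷ (25 , 822757408) ∷ (13 , 407509024) ∷ (31 , 545392672) ∷ []) ∷
     (268896127 , 285887024 ∷ 545296448 ∷ [] , (28 , 545396900) ∷ (6 , 545392672) ∷ (23 , 171450401) ∷ (31 ,
     817281255) ∷ []) ∷ (2147944319 , 285887024 ∷ 545296448 ∷ 822757920 ∷ [] , (28 , 562969020) ∷ (6 ,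
     545392672) ∷ (7 , 817281255) ∷ []) ∷ (18024319 , 545329184 ∷ 562170416 ∷ 541328448 ∷ [] , (28 ,
     545392672) ∷ (6 , 541138976) ∷ (14 , 137109800) ∷ (15 , 545392672) ∷ []) ∷ (34801535 , 539247744 ∷ [] ,
     (28 , 562186272) ∷ (6 , 541138976) ∷ (14 , 545663272) ∷ (15 , 545392672) ∷ []) ∷ (68355967 , 545599784 ∷
     545933360 ∷ [] , (28 , 545401128) ∷ (6 , 541329440) ∷ (9 , 285249600) ∷ (21 , 541106240) ∷ (13 ,
     311308484) ∷ (29 , 566923988) ∷ (7 , 545392672) ∷ (15 , 545392672) ∷ []) ∷ (1074988927 , 562711072 ∷
     541328448 ∷ [] , (28 , 545405356) ∷ (26 , 545591328) ∷ (6 , 675682464) ∷ (22 , 541155888) ∷ (14 ,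
     143395112) ∷ (3 , 545392672) ∷ (19 , 545392672) ∷ (11 , 545392672) ∷ (31 , 545392672) ∷ []) ∷
     (1342375807 , 545329184 ∷ 545663272 ∷ 285346016 ∷ [] , (28 , 545396900) ∷ (6 , 204023840) ∷ (9 ,
     171196449) ∷ (25 , 291607783) ∷ (5 , 541328448) ∷ []) ∷ (3221423999 , 551717921 ∷ 545933872 ∷ 545663272
     ∷ [] , (28 , 545667500) ∷ (6 , 545392672) ∷ (5 , 545392672) ∷ []) ∷ (554764159 , 545329184 ∷ 562170416 ∷
     562711264 ∷ [] , (28 , 545392672) ∷ (6 , 204023904) ∷ (14 , 137109800) ∷ (17 , 690013489) ∷ (9 ,
     285345824) ∷ (21 , 559646645) ∷ (13 , 273159232) ∷ []) ∷ (1108412287 , 285553064 ∷ [] , (28 , 813836448)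
     ∷ (6 , 136847392) ∷ (17 , 545392672) ∷ (9 , 296069314) ∷ (25 , 958164488) ∷ []) ∷ (160760639 , 545933600
     ∷ 545329184 ∷ 578947600 ∷ [] , (12 , 823816684) ∷ (6 , 230231104) ∷ (17 , 319329393) ∷ (23 , 545392672)
     ∷ []) ∷ (2484405055 , 547631400 ∷ 78889952 ∷ [] , (12 , 407032032) ∷ (17 , 557094449) ∷ []) ∷ [])
  ∷ ((32767 , 545393184 ∷ 545392928 ∷ 545392800 ∷ 545392736 ∷ [] , (30 , 545392672) ∷ (1 , 545392672) ∷ []) ∷
     (81919 , 562169888 ∷ 541329440 ∷ 551688290 ∷ [] , (14 , 545392672) ∷ (17 , 545392672) ∷ (9 , 545392672)
     ∷ []) ∷ (204799 , 562169888 ∷ 545663008 ∷ 545329184 ∷ 545458274 ∷ [] , (22 , 545392672) ∷ (14 ,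
     285345824) ∷ (9 , 545392672) ∷ (5 , 545392672) ∷ []) ∷ (1122303 , 285345824 ∷ 813828128 ∷ 545392800 ∷
     545409584 ∷ [] , (22 , 541329440) ∷ (17 , 545392672) ∷ (3 , 545392672) ∷ []) ∷ (462847 , 545916960 ∷
     545654816 ∷ 545329184 ∷ 545458274 ∷ [] , (6 , 545392672) ∷ (25 , 545392672) ∷ (5 , 545392672) ∷ []) ∷
     (1249279 , 562186272 ∷ 545400864 ∷ 545396900 ∷ [] , (6 , 545392672) ∷ (9 , 545392672) ∷ (21 , 545392672)
     ∷ (13 , 545392672) ∷ (3 , 545392672) ∷ []) ∷ (17895423 , 822217264 ∷ 562170680 ∷ 545460260 ∷ [] , (6 ,
     545392672) ∷ (17 , 545392672) ∷ (7 , 545392672) ∷ (23 , 545392672) ∷ []) ∷ (464895 , 285345824 ∷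
     814098720 ∷ 545396900 ∷ [] , (26 , 545392672) ∷ (22 , 541329440) ∷ (25 , 545391680) ∷ (5 , 545392672) ∷
     (21 , 545392672) ∷ (3 , 545392672) ∷ []) ∷ (4397055 , 407509024 ∷ 545418040 ∷ [] , (26 , 545663008) ∷ (9
     , 285345824) ∷ (29 , 549585984) ∷ (3 , 545392672) ∷ []) ∷ (16979967 , 541329440 ∷ 562711072 ∷ 562694704
     ∷ [] , (26 , 545329184) ∷ (14 , 273156128) ∷ (9 , 545392672) ∷ (13 , 545392672) ∷ (19 , 545392672) ∷ (11
     , 545392672) ∷ (15 , 545392672) ∷ (31 , 545392672) ∷ []) ∷ (25237503 , 273156128 ∷ 683804836 ∷ [] , (26
     , 546272036) ∷ (17 , 407521460) ∷ (19 , 545392736) ∷ (31 , 545392672) ∷ []) ∷ (17238015 , 545654816 ∷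
     545391680 ∷ 285345824 ∷ 813836576 ∷ [] , (26 , 545329184) ∷ (6 , 545392672) ∷ (19 , 539009152) ∷ (7 ,
     545392672) ∷ []) ∷ (18024447 , 562170416 ∷ 541328448 ∷ [] , (26 , 545392672) ∷ (6 , 541329440) ∷ (14 ,
     549718048) ∷ (19 , 545392672) ∷ (11 , 545392672) ∷ (15 , 545392672) ∷ []) ∷ (50530303 , 545916960 ∷
     545654816 ∷ 539009152 ∷ [] , (26 , 545329184) ∷ (6 , 545392672) ∷ (5 , 545392672) ∷ []) ∷ (84084735 ,
     545654816 ∷ 545933360 ∷ 285345888 ∷ [] , (26 , 545329184) ∷ (6 , 545392672) ∷ (9 , 270581888) ∷ (5 ,
     545392672) ∷ []) ∷ (285411327 , 562170416 ∷ 562186784 ∷ 545396900 ∷ [] , (26 , 545458274) ∷ (6 ,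
     541329440) ∷ (14 , 549718048) ∷ (30 , 566495264) ∷ (9 , 545392672) ∷ (5 , 541328448) ∷ (13 , 549717056)
     ∷ (19 , 545392736) ∷ (11 , 285345888) ∷ []) ∷ (286328831 , 822217264 ∷ 545396772 ∷ 545392736 ∷ [] , (26
     , 545392672) ∷ (6 , 151259168) ∷ (30 , 956565536) ∷ (17 , 541328448) ∷ []) ∷ (554764287 , 545917024 ∷
     562190500 ∷ [] , (26 , 545392672) ∷ (6 , 675678436) ∷ (14 , 159648040) ∷ (17 , 558646848) ∷ (9 ,
     285345824) ∷ []) ∷ (1513343 , 273156128 ∷ 683808928 ∷ 545391680 ∷ [] , (28 , 545392672) ∷ (26 ,
     545329184) ∷ (3 , 545392672) ∷ (19 , 545392672) ∷ (31 , 545392672) ∷ []) ∷ (2561919 , 558647328 ∷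
     545932880 ∷ [] , (28 , 545392672) ∷ (26 , 285299248) ∷ (14 , 272711712) ∷ (3 , 545329184) ∷ (11 ,
     545392672) ∷ (15 , 545392672) ∷ []) ∷ (268900223 , 545329184 ∷ 285345824 ∷ [] , (28 , 545396900) ∷ (22 ,
     541138976) ∷ (30 , 220537194) ∷ (25 , 545296448) ∷ (5 , 151259168) ∷ (21 , 558647328) ∷ (29 , 814098720)
     ∷ (23 , 218204418) ∷ (31 , 545392672) ∷ []) ∷ (2147948415 , 545329184 ∷ 285345824 ∷ 814098720 ∷ [] , (28
     , 285375420) ∷ (22 , 541138976) ∷ (25 , 546082880) ∷ (5 , 545392672) ∷ (21 , 541853264) ∷ (7 ,
     545392672) ∷ []) ∷ (138614655 , 545329696 ∷ 562710560 ∷ [] , (28 , 558655784) ∷ (22 , 541143204) ∷ (14 ,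
     413417768) ∷ (9 , 545567048) ∷ (5 , 151259168) ∷ (29 , 550277316) ∷ (7 , 409604128) ∷ (15 , 545392672) ∷
     []) ∷ (3221428095 , 562710560 ∷ 539234784 ∷ [] , (28 , 545405356) ∷ (14 , 272711712) ∷ (9 , 814098720) ∷
     []) ∷ (1091766143 , 545329184 ∷ 562711072 ∷ 541328448 ∷ [] , (28 , 545392672) ∷ (6 , 220276832) ∷ (22 ,
     690495536) ∷ (14 , 203831182) ∷ (31 , 545392672) ∷ []) ∷ (1108543359 , 556025488 ∷ [] , (28 , 562186272)
     ∷ (6 , 541138976) ∷ (14 , 545663272) ∷ (31 , 545392672) ∷ []) ∷ (336791423 , 545599784 ∷ 541328448 ∷ []
     , (28 , 545396900) ∷ (6 , 141176864) ∷ (22 , 151213972) ∷ (15 , 284530671) ∷ (31 , 545392672) ∷ []) ∷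
     (1142097791 , 545599784 ∷ 345138209 ∷ [] , (28 , 541336904) ∷ (22 , 480879659) ∷ (9 , 270012736) ∷ (25 ,
     270289816) ∷ (29 , 566923988) ∷ (23 , 564775106) ∷ []) ∷ (3222472575 , 551717921 ∷ 562170416 ∷ 542573665
     ∷ [] , (28 , 551985292) ∷ (6 , 675682464) ∷ (3 , 545392672) ∷ (19 , 545392672) ∷ []) ∷ (697631551 ,
     566384804 ∷ 541138976 ∷ 632380512 ∷ [] , (12 , 815160460) ∷ (17 , 307348017) ∷ (31 , 545392672) ∷ []) ∷
     [])
  ∷ ((65535 , 826884656 ∷ 567108408 ∷ [] , []) ∷ (98303 , 826884656 ∷ 688743224 ∷ [] , []) ∷ (212991 ,
     562711088 ∷ 541401384 ∷ 545393184 ∷ [] , []) ∷ (344063 , 545401128 ∷ 545460388 ∷ 545916960 ∷ 545392928 ∷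
     [] , []) ∷ (466943 , 545401128 ∷ 545460388 ∷ 822217248 ∷ [] , []) ∷ (1253375 , 545401128 ∷ 545396900 ∷
     562711072 ∷ 562169888 ∷ [] , []) ∷ (17899519 , 285345824 ∷ 813828128 ∷ 545460260 ∷ [] , []) ∷ (987135 ,
     562981688 ∷ 545461380 ∷ [] , []) ∷ (1511423 , 545396900 ∷ 545409056 ∷ 822741536 ∷ [] , []) ∷ (3346431 ,
     541336904 ∷ 562186272 ∷ 545400864 ∷ [] , []) ∷ (5443583 , 545396900 ∷ 285362336 ∷ 545917472 ∷ [] , []) ∷
     (18026495 , 562170416 ∷ 545392936 ∷ 545329184 ∷ 545933856 ∷ [] , []) ∷ (286330879 , 562170680 ∷
     545460388 ∷ 545460260 ∷ [] , []) ∷ (554766335 , 545392936 ∷ 545984676 ∷ 545460260 ∷ [] , []) ∷ (1513471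
     , 826804272 ∷ 688662840 ∷ 545391680 ∷ [] , []) ∷ (2562047 , 545396900 ∷ 558647328 ∷ 545915968 ∷ [] , [])
     ∷ (17242111 , 285345824 ∷ 814098720 ∷ [] , []) ∷ (21174271 , 428083496 ∷ [] , []) ∷ (50534399 ,
     545409584 ∷ 541329440 ∷ 562710560 ∷ 545392736 ∷ [] , []) ∷ (84088831 , 545401128 ∷ 285345888 ∷ [] , [])
     ∷ (1090721791 , 428083560 ∷ 411847544 ∷ [] , []) ∷ (2164463615 , 562694704 ∷ 558660012 ∷ 541329440 ∷
     562711072 ∷ [] , []) ∷ (2172721151 , 826804784 ∷ 545421372 ∷ 545392736 ∷ [] , []) ∷ (285673471 ,
     285345824 ∷ 813836576 ∷ 545396900 ∷ 545391680 ∷ [] , []) ∷ (51578879 , 562170416 ∷ 541328448 ∷ 562186272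
     ∷ 539009152 ∷ [] , []) ∷ (85133311 , 545933360 ∷ 545401128 ∷ [] , []) ∷ (1091766271 , 562711072 ∷
     541328448 ∷ 545405356 ∷ [] , []) ∷ (18290559 , 285345824 ∷ 818226432 ∷ [] , []) ∷ (35067775 , 539026064
     ∷ 541329440 ∷ [] , []) ∷ (2148996991 , 285345824 ∷ 818161952 ∷ 545391680 ∷ [] , []) ∷ (69670783 ,
     822120528 ∷ 562168912 ∷ [] , []) ∷ (1076303743 , 545932880 ∷ 562711072 ∷ [] , []) ∷ (2416383871 ,
     285345824 ∷ 545329184 ∷ 752981031 ∷ [] , []) ∷ (1212356479 , 360985120 ∷ [] , []) ∷ (3239249791 ,
     562170416 ∷ 544614664 ∷ 548803716 ∷ [] , []) ∷ (3256027007 , 548597892 ∷ 550833218 ∷ [] , []) ∷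
     (2484275071 , 541241540 ∷ 645249452 ∷ [] , []) ∷ (2845115199 , 847923728 ∷ 670700676 ∷ [] , []) ∷ [])
  ∷ []

theorem3p1 : (r 3 ⟨ℤ/ 4 ^ 1 ⟩≐ 2)
    × (r 3 ⟨ℤ/ 4 ^ 2 ⟩≐ 6)
    × (r 3 ⟨ℤ/ 4 ^ 3 ⟩≐ 16)
    × (r 3 ⟨ℤ/ 4 ^ 4 ⟩≐ 42)
    × (r 3 ⟨ℤ/ 4 ^ 5 ⟩≐ 124)
theorem3p1 =
  -- The second argument is the weight threshold `t`. Counted by the weight of `u`, starting from
  -- `t`, the sets have sizes 2; 4 + 2; 12 + 4; 24 + 16 + 2; and 80 + 40 + 4 (for n = 5: ten fibres
  -- of 8, five of 8, one of 4).
  exactly 1 1 levels1 tt refl tt ,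
  exactly 2 1 levels2 tt refl tt ,
  exactly 3 2 levels3 tt refl tt ,
  exactly 4 2 levels4 tt refl tt ,
  exactly 5 3 levels5 tt refl tt
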